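{- Let $p$ be a prime, let $k\in\mathbb{N}$ be relatively prime to $p$, and let $r$ be the order of $p$ in $(\mathbb{Z}/k\mathbb{Z})^\times$. If $u\in\mathbb{N}$ is relatively prime to $r$ and $\gamma_p(k)\leq p^u$, then \[ v(p,k)\leq 2(p^u-1)+\mathbf{1}_{p^u}(\gamma_p(k)). \]
   Context: Let $F$ be an algebraically closed field of characteristic $p>0$. For $k\in\mathbb{N}$, $v(p,k)$ denotes the smallest natural number $s$ such that every polynomial in $F[t]$ can be written as a sum of at most $s$ $k$-th powers of polynomials in $F[t]$ (with no restriction on the degrees of the polynomials being raised to the $k$-th power); if no such $s$ exists, $v(p,k)=\infty$. For an integer $q\geq 2$, $\gamma_q(k)$ denotes the sum of the digits of the base-$q$ expansion of $k$. The indicator function is $\mathbf{1}_M(x)=1$ if $x=M$ and $\mathbf{1}_M(x)=0$ if $x\neq M$. -}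

module Defs where

open import Level using (Level; _⊔_)
open import Algebra.Apartness.Bundles using (HeytingField; HeytingCommutativeRing)
open import Algebra.Bundles using (CommutativeRing)
open import Algebra.Bundles.Raw using (RawSemiring)
import Algebra.Definitions.RawMonoid as RawMonoidDefinitions
import Algebra.Definitions.RawSemiring as RawSemiringDefinitions
open import Data.Bool.Base using (if_then_else_)
open import Data.Digit using (toDigits)
open import Data.Fin.Base using (toℕ)
import Data.List.Base as List
open List using (List; []; _∷_)
open import Data.Nat.Base using (ℕ; zero; suc; _^_; _≤_; _<_; ∣_-_∣; NonTrivial; nonTrivial⇒n>1)
open import Data.Nat.Divisibility using (_∣_)
open import Data.Nat.ListAction using () renaming (sum to sumₙ)
open import Data.Nat.Properties using (_≟_)
open import Data.Product.Base using (∃-syntax; Σ-syntax; _×_; proj₁)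
open import Data.Vec.Functional using (Vector)
open import Function.Bundles using (_⇔_)
open import Relation.Binary.Construct.Add.Supremum.NonStrict {A = ℕ} _≤_ public
  using () renaming (_≤⁺_ to _≤∞_)
open import Relation.Nullary.Construct.Add.Supremum using (_⁺; [_]; ⊤⁺)
open import Relation.Nullary.Decidable using (does; fromWitness)
open import Relation.Nullary.Negation using (¬_)

infix 4 _≡_[mod_]

_≡_[mod_] : ℕ → ℕ → ℕ → Set
a ≡ b [mod k ] = k ∣ ∣ a - b ∣

record IsMultiplicativeOrder (a k r : ℕ) : Set where
  field
    positive : 1 ≤ r
    a^r≡1    : a ^ r ≡ 1 [mod k ]
    minimal  : ∀ {m} → 1 ≤ m → a ^ m ≡ 1 [mod k ] → r ≤ m

γ : (q : ℕ) .{{_ : NonTrivial q}} → ℕ → ℕ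
γ q k = sumₙ (List.map toℕ (proj₁ (toDigits q {fromWitness (nonTrivial⇒n>1 q)} k)))

𝟏 : ℕ → ℕ → ℕ
𝟏 M x = if does (x ≟ M) then 1 else 0

ℕ∞ : Set
ℕ∞ = ℕ ⁺

pattern fin n = [ n ]
pattern ∞     = ⊤⁺

-- Apartness in a Heyting field is tight and x # y holds exactly when
-- x - y is invertible, so nonzero (# 0#) means invertible; 1# # 0# is
-- a consequence of the axioms. No decidability of _≈_ or _#_ is assumed.

module _ {c ℓ₁ ℓ₂ : Level} (F : HeytingField c ℓ₁ ℓ₂) where

  open HeytingField F
  open CommutativeRing (HeytingCommutativeRing.commutativeRing heytingCommutativeRing)
    using (+-rawMonoid)
  open RawMonoidDefinitions +-rawMonoid using () renaming (_×_ to _·_)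

  HasCharacteristic : ℕ → Set ℓ₁
  HasCharacteristic p = ∀ n → (n · 1# ≈ 0#) ⇔ (p ∣ n)

  -- Coefficients with the constant term first. Trailing zeros are
  -- allowed and are identified away by _≈ₚ_.
  Poly : Set c
  Poly = List Carrier

  coeff : Poly → ℕ → Carrier
  coeff []      n       = 0#
  coeff (a ∷ f) zero    = a
  coeff (a ∷ f) (suc n) = coeff f n

  infix  4 _≈ₚ_
  infixl 6 _+ₚ_
  infixl 7 _*ₚ_

  _≈ₚ_ : Poly → Poly → Set ℓ₁
  f ≈ₚ g = ∀ n → coeff f n ≈ coeff g n

  _+ₚ_ : Poly → Poly → Poly
  []      +ₚ g       = g
  (a ∷ f) +ₚ []      = a ∷ f
  (a ∷ f) +ₚ (b ∷ g) = a + b ∷ f +ₚ g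

  _*ₚ_ : Poly → Poly → Poly
  []      *ₚ g = []
  (a ∷ f) *ₚ g = List.map (a *_) g +ₚ (0# ∷ f *ₚ g)

  polyRawSemiring : RawSemiring c ℓ₁
  polyRawSemiring = record
    { Carrier = Poly
    ; _≈_     = _≈ₚ_
    ; _+_     = _+ₚ_
    ; _*_     = _*ₚ_
    ; 0#      = []
    ; 1#      = 1# ∷ []
    }

  eval : Poly → Carrier → Carrier
  eval []      x = 0#
  eval (a ∷ f) x = a + x * eval f x

  HasDegree : Poly → ℕ → Set (ℓ₁ ⊔ ℓ₂)
  HasDegree f d = coeff f d # 0# × (∀ {n} → d < n → coeff f n ≈ 0#)

  AlgebraicallyClosed : Set (c ⊔ ℓ₁ ⊔ ℓ₂)
  AlgebraicallyClosed = ∀ f {d} → HasDegree f d → 1 ≤ d → ∃[ x ] eval f x ≈ 0#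

  open RawSemiringDefinitions polyRawSemiring using (sum) renaming (_^_ to _^ₚ_)

  IsSumOfAtMost : (s k : ℕ) → Poly → Set (c ⊔ ℓ₁)
  IsSumOfAtMost s k f =
    ∃[ m ] Σ[ g ∈ Vector Poly m ] (m ≤ s × f ≈ₚ sum (λ i → g i ^ₚ k))

  EveryPolyIsSumOfAtMost : (s k : ℕ) → Set (c ⊔ ℓ₁)
  EveryPolyIsSumOfAtMost s k = ∀ f → IsSumOfAtMost s k f

  -- "v(p,k) = v". This is a relation since the existence of a least s,
  -- or of the case distinction between finite and infinite values, is
  -- not constructive; classically exactly one v satisfies it.
  IsWaringNumber : ℕ → ℕ∞ → Set (c ⊔ ℓ₁)
  IsWaringNumber k (fin s) =
    EveryPolyIsSumOfAtMost s k × (∀ {s′} → EveryPolyIsSumOfAtMost s′ k → s ≤ s′)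
  IsWaringNumber k ∞       = ∀ s → ¬ EveryPolyIsSumOfAtMost s k

  -- "v(p,k) ≤ n". The two components are classically equivalent. The
  -- first is kept so that the bound has content even when no v with
  -- IsWaringNumber k v can be exhibited.
  WaringNumber≤ : (k n : ℕ) → Set (c ⊔ ℓ₁)
  WaringNumber≤ k n =
    EveryPolyIsSumOfAtMost n k × (∀ v → IsWaringNumber k v → v ≤∞ fin n)

{-# OPTIONS --safe #-}
module Submission where

open import Defs hiding (_≈ₚ_; _+ₚ_; _*ₚ_)
import Defs
open import Level using (Level; _⊔_)
open import Algebra.Apartness.Bundles using (HeytingField; HeytingCommutativeRing)
open import Algebra.Bundles using (CommutativeRing)
open import Algebra.Morphism.Structures using (IsRingHomomorphism)
open import Data.Bool.Base using (if_then_else_)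
open import Data.Digit using (Expansion; fromDigits; toDigits)
open import Data.Empty using (⊥-elim)
open import Data.Fin.Base as Fin using (Fin)
open import Data.Fin.Properties using (toℕ-inject₁; toℕ-fromℕ; toℕ<n)
open import Data.List.Base as List using (List; []; _∷_; _++_; length; replicate; map)
open import Data.List.Properties using (length-++; length-replicate; length-map; map-++; map-∘; map-replicate)
open import Data.Nat.Base as ℕ using (ℕ; zero; suc; _<_; _≤_; s≤s; z≤n; _!)
open import Data.Nat.Combinatorics using (_C_; nCn≡1; nCk≡n!/k![n-k]!; k![n∸k]!∣n!)
open import Data.Nat.Coprimality using (Coprime; coprime-Bézout)
open import Data.Nat.Divisibility using (_∣_; _∤_; divides; ∣-refl; ∣m∣n⇒∣m+n; m∣m*n; >⇒∤; ∣⇒≤)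
open import Data.Nat.DivMod using (m/n*n≡m)
open import Data.Nat.GCD using (module Bézout)
open import Data.Nat.ListAction using () renaming (sum to sumₙ)
open import Data.Nat.ListAction.Properties using (sum-++)
open import Data.Nat.Primality using (Prime; euclidsLemma; prime⇒nonTrivial; prime⇒nonZero; ¬prime[1])
open import Data.Nat.Properties as ℕ using (_!*_!≢0)
open import Data.Nat.Solver using (module +-*-Solver)
open import Data.Product.Base using (_×_; _,_; ∃-syntax; proj₁; proj₂)
open import Data.Sum.Base using (inj₁; inj₂)
open import Data.Vec.Functional as Vector using (Vector)
open import Function.Bundles using (Equivalence)
open import Relation.Binary.Bundles using (Setoid)
open import Relation.Binary.Construct.Add.Supremum.NonStrict {A = ℕ} _≤_ using ([_])
open import Relation.Binary.PropositionalEquality as ≡ using (_≡_; _≢_)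
open import Relation.Binary.Structures using (IsEquivalence)
open import Relation.Nullary.Decidable using (dec-true; dec-false; fromWitness)
import Algebra.Definitions.RawSemiring as RawSemiringDefinitions
import Algebra.Properties.Semiring.Exp as Exp
import Algebra.Properties.Semiring.Mult as Mult
import Algebra.Solver.Ring.NaturalCoefficients.Default as NaturalSolver
import Relation.Binary.Reasoning.Setoid as SetoidReasoning

-- Write q = p^u, and let γ = γ_p(k) ≤ q. Since u is invertible modulo r, p is a power of q modulo k,
-- so the γ powers of p that make up k can be traded for powers of q: k divides some
-- K = 1 + q^e₂ + ⋯ + q^e_γ, and it suffices to use K-th powers with arbitrary coefficients, each
-- constant being a k-th power. For a in F_q and w = q - γ,
--   a^w (x + a)^K = a^w (x + a) (x^(q^e₂) + a) ⋯ (x^(q^e_γ) + a)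
-- is a polynomial in a of degree q, and summing over F_q leaves the coefficient of a^(q-1), up to a
-- constant: T(x) := Σ_a a^w (x + a)^K = κ - L(x) with L(x) = x + x^(q^e₂) + ⋯ + x^(q^e_γ).
-- As r and 1 + r are coprime, we may take e₂, …, e_γ ≡ 1 modulo 1 + r. For α in F_{q^(1+r)} outside
-- F_q the powers α^(q^eᵢ) with i ≥ 2 then all equal α^q, so T(α x) - α^q T(x) = (α^q - α) x + constant,
-- and every polynomial has this form. The terms with a = 0 vanish if w > 0 and merge into one if
-- w = 0, which leaves 2 (q - 1) terms, and one more if γ = q.

-- The commutative ring of polynomials over the field

module Polynomials {c ℓ₁ ℓ₂ : Level} (F : HeytingField c ℓ₁ ℓ₂) where

  𝔽 : CommutativeRing c ℓ₁
  𝔽 = HeytingCommutativeRing.commutativeRing (HeytingField.heytingCommutativeRing F)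

  open CommutativeRing 𝔽 hiding (zero)
  open SetoidReasoning setoid
  open NaturalSolver commutativeSemiring using (solve; con; _:+_; _:*_; _:=_)

  infix  4 _≈ₚ_
  infix  8 -ₚ_
  infixl 6 _+ₚ_
  infixl 7 _*ₚ_ _∙ₚ_

  -- A record, so that the two polynomials can be inferred from an equality.
  record _≈ₚ_ (f g : Poly F) : Set ℓ₁ where
    field at : Defs._≈ₚ_ F f g
  open _≈ₚ_ public

  _+ₚ_ _*ₚ_ : Poly F → Poly F → Poly F
  _+ₚ_ = Defs._+ₚ_ F
  _*ₚ_ = Defs._*ₚ_ F

  _∙ₚ_ : Carrier → Poly F → Poly F
  a ∙ₚ f = List.map (a *_) f

  -ₚ_ : Poly F → Poly F
  -ₚ f = List.map -_ f

  coeff-+ : ∀ f g n → coeff F (f +ₚ g) n ≈ coeff F f n + coeff F g n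
  coeff-+ []      g       n       = sym (+-identityˡ _)
  coeff-+ (a ∷ f) []      n       = sym (+-identityʳ _)
  coeff-+ (a ∷ f) (b ∷ g) zero    = refl
  coeff-+ (a ∷ f) (b ∷ g) (suc n) = coeff-+ f g n

  coeff-∙ : ∀ a f n → coeff F (a ∙ₚ f) n ≈ a * coeff F f n
  coeff-∙ a []      n       = sym (zeroʳ a)
  coeff-∙ a (b ∷ f) zero    = refl
  coeff-∙ a (b ∷ f) (suc n) = coeff-∙ a f n

  coeff-neg : ∀ f n → coeff F (-ₚ f) n ≈ - coeff F f n
  coeff-neg []      n       = sym -0#≈0#
    where open import Algebra.Properties.Ring ring using (-0#≈0#)
  coeff-neg (a ∷ f) zero    = refl
  coeff-neg (a ∷ f) (suc n) = coeff-neg f n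

  +ₚ-cong : ∀ {f f′ g g′} → f ≈ₚ f′ → g ≈ₚ g′ → f +ₚ g ≈ₚ f′ +ₚ g′
  +ₚ-cong {f} {f′} {g} {g′} f≈f′ g≈g′ .at n = begin
    coeff F (f +ₚ g) n           ≈⟨ coeff-+ f g n ⟩
    coeff F f n + coeff F g n    ≈⟨ +-cong (at f≈f′ n) (at g≈g′ n) ⟩
    coeff F f′ n + coeff F g′ n  ≈⟨ coeff-+ f′ g′ n ⟨
    coeff F (f′ +ₚ g′) n         ∎

  +ₚ-assoc : ∀ f g h → (f +ₚ g) +ₚ h ≈ₚ f +ₚ (g +ₚ h)
  +ₚ-assoc f g h .at n = begin
    coeff F ((f +ₚ g) +ₚ h) n                   ≈⟨ coeff-+ (f +ₚ g) h n ⟩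
    coeff F (f +ₚ g) n + coeff F h n            ≈⟨ +-congʳ (coeff-+ f g n) ⟩
    coeff F f n + coeff F g n + coeff F h n     ≈⟨ +-assoc _ _ _ ⟩
    coeff F f n + (coeff F g n + coeff F h n)   ≈⟨ +-congˡ (coeff-+ g h n) ⟨
    coeff F f n + coeff F (g +ₚ h) n            ≈⟨ coeff-+ f (g +ₚ h) n ⟨
    coeff F (f +ₚ (g +ₚ h)) n                   ∎

  +ₚ-comm : ∀ f g → f +ₚ g ≈ₚ g +ₚ f
  +ₚ-comm f g .at n = begin
    coeff F (f +ₚ g) n         ≈⟨ coeff-+ f g n ⟩
    coeff F f n + coeff F g n  ≈⟨ +-comm _ _ ⟩
    coeff F g n + coeff F f n  ≈⟨ coeff-+ g f n ⟨
    coeff F (g +ₚ f) n         ∎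

  -ₚ-inverseˡ : ∀ f → (-ₚ f) +ₚ f ≈ₚ []
  -ₚ-inverseˡ f .at n = begin
    coeff F ((-ₚ f) +ₚ f) n          ≈⟨ coeff-+ (-ₚ f) f n ⟩
    coeff F (-ₚ f) n + coeff F f n   ≈⟨ +-congʳ (coeff-neg f n) ⟩
    - coeff F f n + coeff F f n      ≈⟨ -‿inverseˡ _ ⟩
    0#                               ∎

  -ₚ-cong : ∀ {f g} → f ≈ₚ g → -ₚ f ≈ₚ -ₚ g
  -ₚ-cong {f} {g} f≈g .at n = trans (coeff-neg f n) (trans (-‿cong (at f≈g n)) (sym (coeff-neg g n)))

  shift : Poly F → Poly F
  shift f = 0# ∷ f

  shift-cong : ∀ {f g} → f ≈ₚ g → shift f ≈ₚ shift g
  shift-cong f≈g .at zero    = refl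
  shift-cong f≈g .at (suc n) = at f≈g n

  coeff-shift-+ : ∀ f g n →
    coeff F (shift (f +ₚ g)) n ≈ coeff F (shift f) n + coeff F (shift g) n
  coeff-shift-+ f g zero    = sym (+-identityˡ 0#)
  coeff-shift-+ f g (suc n) = coeff-+ f g n

  coeff-shift-∙ : ∀ a f n → coeff F (shift (a ∙ₚ f)) n ≈ a * coeff F (shift f) n
  coeff-shift-∙ a f zero    = sym (zeroʳ a)
  coeff-shift-∙ a f (suc n) = coeff-∙ a f n

  coeff-*-∷ˡ : ∀ a f g n →
    coeff F ((a ∷ f) *ₚ g) n ≈ a * coeff F g n + coeff F (shift (f *ₚ g)) n
  coeff-*-∷ˡ a f g n = trans (coeff-+ (a ∙ₚ g) _ n) (+-congʳ (coeff-∙ a g n))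

  -- Multiplication recurses on the left factor; this mirror image of `coeff-*-∷ˡ` is what closes
  -- the induction for commutativity.
  coeff-*-∷ʳ : ∀ f b g n →
    coeff F (f *ₚ (b ∷ g)) n ≈ b * coeff F f n + coeff F (shift (f *ₚ g)) n
  coeff-*-∷ʳ []      b g zero    =
    solve 1 (λ b → con 0 := b :* con 0 :+ con 0) refl b
  coeff-*-∷ʳ []      b g (suc n) =
    solve 1 (λ b → con 0 := b :* con 0 :+ con 0) refl b
  coeff-*-∷ʳ (a ∷ f) b g zero    =
    solve 2 (λ a b → a :* b :+ con 0 := b :* a :+ con 0) refl a b
  coeff-*-∷ʳ (a ∷ f) b g (suc n) = begin
    coeff F ((a ∷ f) *ₚ (b ∷ g)) (suc n)                                      ≈⟨ coeff-*-∷ˡ a f (b ∷ g) (suc n) ⟩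
    a * coeff F g n + coeff F (f *ₚ (b ∷ g)) n                                ≈⟨ +-congˡ (coeff-*-∷ʳ f b g n) ⟩
    a * coeff F g n + (b * coeff F f n + coeff F (shift (f *ₚ g)) n)          ≈⟨ solve 3 (λ x y z → x :+ (y :+ z) := y :+ (x :+ z)) refl _ _ _ ⟩
    b * coeff F f n + (a * coeff F g n + coeff F (shift (f *ₚ g)) n)          ≈⟨ +-congˡ (coeff-*-∷ˡ a f g n) ⟨
    b * coeff F (a ∷ f) (suc n) + coeff F (shift ((a ∷ f) *ₚ g)) (suc n)      ∎

  *ₚ-comm : ∀ f g → f *ₚ g ≈ₚ g *ₚ f
  *ₚ-comm []      []      .at n = refl
  *ₚ-comm []      (b ∷ g) .at n = begin
    0#                                       ≈⟨ solve 1 (λ b → con 0 := b :* con 0 :+ con 0) refl b ⟩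
    b * 0# + 0#                              ≈⟨ +-congˡ (shift-[] n) ⟨
    b * 0# + coeff F (shift []) n            ≈⟨ +-congˡ (at (shift-cong (*ₚ-comm [] g)) n) ⟩
    b * 0# + coeff F (shift (g *ₚ [])) n     ≈⟨ coeff-*-∷ˡ b g [] n ⟨
    coeff F ((b ∷ g) *ₚ []) n                ∎
    where
    shift-[] : ∀ n → coeff F (shift []) n ≈ 0#
    shift-[] zero    = refl
    shift-[] (suc n) = refl
  *ₚ-comm (a ∷ f) g .at n = begin
    coeff F ((a ∷ f) *ₚ g) n                        ≈⟨ coeff-*-∷ˡ a f g n ⟩
    a * coeff F g n + coeff F (shift (f *ₚ g)) n    ≈⟨ +-congˡ (at (shift-cong (*ₚ-comm f g)) n) ⟩
    a * coeff F g n + coeff F (shift (g *ₚ f)) n    ≈⟨ coeff-*-∷ʳ g a f n ⟨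
    coeff F (g *ₚ (a ∷ f)) n                        ∎

  -- Equal polynomials may be lists of different lengths, so the induction runs on the factor that
  -- stays fixed; commutativity then carries the result over to the other factor.
  *ₚ-congˡ : ∀ f {g g′} → g ≈ₚ g′ → f *ₚ g ≈ₚ f *ₚ g′
  *ₚ-congˡ []      g≈g′ .at n = refl
  *ₚ-congˡ (a ∷ f) {g} {g′} g≈g′ .at n = begin
    coeff F ((a ∷ f) *ₚ g) n                         ≈⟨ coeff-*-∷ˡ a f g n ⟩
    a * coeff F g n + coeff F (shift (f *ₚ g)) n     ≈⟨ +-cong (*-congˡ (at g≈g′ n)) (at (shift-cong (*ₚ-congˡ f g≈g′)) n) ⟩
    a * coeff F g′ n + coeff F (shift (f *ₚ g′)) n   ≈⟨ coeff-*-∷ˡ a f g′ n ⟨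
    coeff F ((a ∷ f) *ₚ g′) n                        ∎

  *ₚ-distribˡ : ∀ f g h → f *ₚ (g +ₚ h) ≈ₚ f *ₚ g +ₚ f *ₚ h
  *ₚ-distribˡ []      g h .at n = refl
  *ₚ-distribˡ (a ∷ f) g h .at n = begin
    coeff F ((a ∷ f) *ₚ (g +ₚ h)) n
      ≈⟨ coeff-*-∷ˡ a f (g +ₚ h) n ⟩
    a * coeff F (g +ₚ h) n + coeff F (shift (f *ₚ (g +ₚ h))) n
      ≈⟨ +-cong (*-congˡ (coeff-+ g h n))
                (trans (at (shift-cong (*ₚ-distribˡ f g h)) n) (coeff-shift-+ (f *ₚ g) (f *ₚ h) n)) ⟩
    a * (coeff F g n + coeff F h n) + (coeff F (shift (f *ₚ g)) n + coeff F (shift (f *ₚ h)) n)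
      ≈⟨ solve 5 (λ a x y z w → a :* (x :+ y) :+ (z :+ w) := (a :* x :+ z) :+ (a :* y :+ w)) refl a _ _ _ _ ⟩
    (a * coeff F g n + coeff F (shift (f *ₚ g)) n) + (a * coeff F h n + coeff F (shift (f *ₚ h)) n)
      ≈⟨ +-cong (coeff-*-∷ˡ a f g n) (coeff-*-∷ˡ a f h n) ⟨
    coeff F ((a ∷ f) *ₚ g) n + coeff F ((a ∷ f) *ₚ h) n
      ≈⟨ coeff-+ ((a ∷ f) *ₚ g) ((a ∷ f) *ₚ h) n ⟨
    coeff F ((a ∷ f) *ₚ g +ₚ (a ∷ f) *ₚ h) n
      ∎

  ≈ₚ-isEquivalence : IsEquivalence _≈ₚ_
  ≈ₚ-isEquivalence = record
    { refl  = λ where .at n → refl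
    ; sym   = λ where f≈g .at n → sym (at f≈g n)
    ; trans = λ where f≈g g≈h .at n → trans (at f≈g n) (at g≈h n)
    }

  polySetoid : Setoid c ℓ₁
  polySetoid = record { isEquivalence = ≈ₚ-isEquivalence }

  module ≈ₚ = Setoid polySetoid
  module ≈R = SetoidReasoning polySetoid

  *ₚ-cong : ∀ {f f′ g g′} → f ≈ₚ f′ → g ≈ₚ g′ → f *ₚ g ≈ₚ f′ *ₚ g′
  *ₚ-cong {f} {f′} {g} {g′} f≈f′ g≈g′ = ≈R.begin
    f *ₚ g    ≈R.≈⟨ *ₚ-congˡ f g≈g′ ⟩
    f *ₚ g′   ≈R.≈⟨ *ₚ-comm f g′ ⟩
    g′ *ₚ f   ≈R.≈⟨ *ₚ-congˡ g′ f≈f′ ⟩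
    g′ *ₚ f′  ≈R.≈⟨ *ₚ-comm g′ f′ ⟩
    f′ *ₚ g′  ≈R.∎

  *ₚ-distribʳ : ∀ h f g → (f +ₚ g) *ₚ h ≈ₚ f *ₚ h +ₚ g *ₚ h
  *ₚ-distribʳ h f g = ≈R.begin
    (f +ₚ g) *ₚ h      ≈R.≈⟨ *ₚ-comm (f +ₚ g) h ⟩
    h *ₚ (f +ₚ g)      ≈R.≈⟨ *ₚ-distribˡ h f g ⟩
    h *ₚ f +ₚ h *ₚ g   ≈R.≈⟨ +ₚ-cong (*ₚ-comm h f) (*ₚ-comm h g) ⟩
    f *ₚ h +ₚ g *ₚ h   ≈R.∎

  ∙ₚ-*ₚ-assoc : ∀ a f g → (a ∙ₚ f) *ₚ g ≈ₚ a ∙ₚ (f *ₚ g)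
  ∙ₚ-*ₚ-assoc a []      g .at n = refl
  ∙ₚ-*ₚ-assoc a (b ∷ f) g .at n = begin
    coeff F ((a ∙ₚ (b ∷ f)) *ₚ g) n                          ≈⟨ coeff-*-∷ˡ (a * b) (a ∙ₚ f) g n ⟩
    a * b * coeff F g n + coeff F (shift ((a ∙ₚ f) *ₚ g)) n  ≈⟨ +-congˡ (at (shift-cong (∙ₚ-*ₚ-assoc a f g)) n) ⟩
    a * b * coeff F g n + coeff F (shift (a ∙ₚ (f *ₚ g))) n  ≈⟨ +-congˡ (coeff-shift-∙ a (f *ₚ g) n) ⟩
    a * b * coeff F g n + a * coeff F (shift (f *ₚ g)) n     ≈⟨ solve 4 (λ a b x y → a :* b :* x :+ a :* y := a :* (b :* x :+ y)) refl a b _ _ ⟩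
    a * (b * coeff F g n + coeff F (shift (f *ₚ g)) n)       ≈⟨ *-congˡ (coeff-*-∷ˡ b f g n) ⟨
    a * coeff F ((b ∷ f) *ₚ g) n                             ≈⟨ coeff-∙ a ((b ∷ f) *ₚ g) n ⟨
    coeff F (a ∙ₚ ((b ∷ f) *ₚ g)) n                          ∎

  shift-*ₚ : ∀ f g → shift f *ₚ g ≈ₚ shift (f *ₚ g)
  shift-*ₚ f g .at n = trans (coeff-*-∷ˡ 0# f g n) (trans (+-congʳ (zeroˡ _)) (+-identityˡ _))

  *ₚ-assoc : ∀ f g h → (f *ₚ g) *ₚ h ≈ₚ f *ₚ (g *ₚ h)
  *ₚ-assoc []      g h = ≈ₚ.refl
  *ₚ-assoc (a ∷ f) g h = ≈R.begin
    (a ∙ₚ g +ₚ shift (f *ₚ g)) *ₚ h          ≈R.≈⟨ *ₚ-distribʳ h (a ∙ₚ g) (shift (f *ₚ g)) ⟩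
    (a ∙ₚ g) *ₚ h +ₚ shift (f *ₚ g) *ₚ h     ≈R.≈⟨ +ₚ-cong (∙ₚ-*ₚ-assoc a g h) (shift-*ₚ (f *ₚ g) h) ⟩
    a ∙ₚ (g *ₚ h) +ₚ shift ((f *ₚ g) *ₚ h)   ≈R.≈⟨ +ₚ-cong ≈ₚ.refl (shift-cong (*ₚ-assoc f g h)) ⟩
    (a ∷ f) *ₚ (g *ₚ h)                      ≈R.∎

  const : Carrier → Poly F
  const a = a ∷ []

  const-* : ∀ a f → const a *ₚ f ≈ₚ a ∙ₚ f
  const-* a f .at zero    = trans (coeff-+ (a ∙ₚ f) (0# ∷ []) zero) (+-identityʳ _)
  const-* a f .at (suc n) = trans (coeff-+ (a ∙ₚ f) (0# ∷ []) (suc n)) (+-identityʳ _)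

  *ₚ-identityˡ : ∀ f → const 1# *ₚ f ≈ₚ f
  *ₚ-identityˡ f .at n = trans (at (const-* 1# f) n) (trans (coeff-∙ 1# f n) (*-identityˡ _))

  polyRing : CommutativeRing c ℓ₁
  polyRing = record
    { Carrier           = Poly F
    ; _≈_               = _≈ₚ_
    ; _+_               = _+ₚ_
    ; _*_               = _*ₚ_
    ; -_                = -ₚ_
    ; 0#                = []
    ; 1#                = const 1#
    ; isCommutativeRing = record
      { isRing = record
        { +-isAbelianGroup = record
          { isGroup = record
            { isMonoid = record
              { isSemigroup = record
                { isMagma = record
                  { isEquivalence = ≈ₚ-isEquivalence
                  ; ∙-cong        = +ₚ-cong
                  }
                ; assoc = +ₚ-assoc
                }
              ; identity = (λ f → ≈ₚ.refl) , λ f → +ₚ-comm f []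
              }
            ; inverse = -ₚ-inverseˡ , λ f → ≈ₚ.trans (+ₚ-comm f (-ₚ f)) (-ₚ-inverseˡ f)
            ; ⁻¹-cong = -ₚ-cong
            }
          ; comm = +ₚ-comm
          }
        ; *-cong     = *ₚ-cong
        ; *-assoc    = *ₚ-assoc
        ; *-identity = *ₚ-identityˡ , λ f → ≈ₚ.trans (*ₚ-comm f (const 1#)) (*ₚ-identityˡ f)
        ; distrib    = *ₚ-distribˡ , *ₚ-distribʳ
        }
      ; *-comm = *ₚ-comm
      }
    }

  const-cong : ∀ {a b} → a ≈ b → const a ≈ₚ const b
  const-cong a≈b .at zero    = a≈b
  const-cong a≈b .at (suc n) = refl

  const-0# : const 0# ≈ₚ []
  const-0# .at zero    = refl
  const-0# .at (suc n) = refl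

  const-homo-* : ∀ a b → const (a * b) ≈ₚ const a *ₚ const b
  const-homo-* a b = ≈ₚ.sym (const-* a (const b))

  const-homo-neg : ∀ a → const (- a) ≈ₚ -ₚ const a
  const-homo-neg a .at n = refl

-- Binomial coefficients modulo a prime

prime∤! : ∀ {p} → Prime p → ∀ {m} → m < p → p ∤ m !
prime∤! p-prime {zero} m<p p∣1 =
  ℕ.<⇒≱ (ℕ.nonTrivial⇒n>1 _ {{prime⇒nonTrivial p-prime}}) (∣⇒≤ p∣1)
prime∤! p-prime {suc m} m<p p∣m! with euclidsLemma (suc m) (m !) p-prime p∣m!
... | inj₁ p∣m = >⇒∤ m<p p∣m
... | inj₂ p∣m! = prime∤! p-prime (ℕ.<⇒≤ m<p) p∣m!

nCk*k!*[n∸k]!≡n! : ∀ {n k} → k ℕ.≤ n → (n C k) ℕ.* (k ! ℕ.* (n ℕ.∸ k) !) ≡ n !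
nCk*k!*[n∸k]!≡n! {n} {k} k≤n =
  ≡.trans (≡.cong (ℕ._* d) (nCk≡n!/k![n-k]! k≤n)) (m/n*n≡m {{d≢0}} (k![n∸k]!∣n! k≤n))
  where
  d = k ! ℕ.* (n ℕ.∸ k) !
  d≢0 = k !* (n ℕ.∸ k) !≢0

-- The binomial coefficient times two factorials is the factorial of the prime, hence divisible by
-- it, while both factorials have arguments below the prime.
prime∣C : ∀ {n} → Prime (suc n) → ∀ {k} → k < n → suc n ∣ suc n C suc k
prime∣C {n} p-prime {k} k<n with euclidsLemma (suc n C suc k) _ p-prime p∣C*d
  where
  p∣C*d : suc n ∣ (suc n C suc k) ℕ.* (suc k ! ℕ.* (n ℕ.∸ k) !)
  p∣C*d = ≡.subst (suc n ∣_) (≡.sym (nCk*k!*[n∸k]!≡n! {suc n} {suc k} (ℕ.<⇒≤ (s≤s k<n)))) (m∣m*n (n !))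
... | inj₁ p∣C = p∣C
... | inj₂ p∣d with euclidsLemma (suc k !) ((n ℕ.∸ k) !) p-prime p∣d
...   | inj₁ p∣k! = ⊥-elim (prime∤! p-prime (s≤s k<n) p∣k!)
...   | inj₂ p∣n-k! = ⊥-elim (prime∤! p-prime (s≤s (ℕ.m∸n≤m n k)) p∣n-k!)

-- Additive powers and weighted power sums in a commutative ring

module RingIdentities {c ℓ} (R : CommutativeRing c ℓ) where

  open CommutativeRing R hiding (zero)
  open SetoidReasoning setoid
  open NaturalSolver commutativeSemiring using (solve; con; _:+_; _:*_; _:=_)
  open import Algebra.Properties.Semiring.Exp semiring
  open import Algebra.Properties.CommutativeSemiring.Exp commutativeSemiring using (^-distrib-*)
  open import Algebra.Properties.Semiring.Mult semiring renaming (_×_ to _·_)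
  open import Algebra.Properties.Semiring.Sum semiring
  open import Algebra.Properties.CommutativeSemiring.Binomial commutativeSemiring
    using (binomialTerm) renaming (theorem to binomial-theorem)

  -- Together with q · 1 = 0, this is the form in which the later argument uses that q is a power of
  -- the characteristic.
  AdditivePower : ℕ → Set _
  AdditivePower m = ∀ x y → (x + y) ^ m ≈ x ^ m + y ^ m

  additivePower-* : ∀ {m n} → AdditivePower m → AdditivePower n → AdditivePower (m ℕ.* n)
  additivePower-* {m} {n} m-add n-add x y = begin
    (x + y) ^ (m ℕ.* n)            ≈⟨ ^-assocʳ (x + y) m n ⟨
    ((x + y) ^ m) ^ n              ≈⟨ ^-congˡ n (m-add x y) ⟩
    (x ^ m + y ^ m) ^ n            ≈⟨ n-add _ _ ⟩
    (x ^ m) ^ n + (y ^ m) ^ n      ≈⟨ +-cong (^-assocʳ x m n) (^-assocʳ y m n) ⟩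
    x ^ (m ℕ.* n) + y ^ (m ℕ.* n)  ∎

  additivePower-^ : ∀ {m} → AdditivePower m → ∀ e → AdditivePower (m ℕ.^ e)
  additivePower-^ m-add zero    x y = trans (*-identityʳ _) (sym (+-cong (*-identityʳ x) (*-identityʳ y)))
  additivePower-^ {m} m-add (suc e) = additivePower-* {m} m-add (additivePower-^ m-add e)

  -- Applied with m = q to the points of F_q, and with m = q^(1+r) to the periodic element α.
  ^-fixed : ∀ {x m} → x ^ m ≈ x → ∀ e → x ^ (m ℕ.^ e) ≈ x
  ^-fixed         x^m≈x zero    = *-identityʳ _
  ^-fixed {x} {m} x^m≈x (suc e) = begin
    x ^ (m ℕ.* m ℕ.^ e)    ≈⟨ ^-assocʳ x m (m ℕ.^ e) ⟨
    (x ^ m) ^ (m ℕ.^ e)    ≈⟨ ^-congˡ (m ℕ.^ e) x^m≈x ⟩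
    x ^ (m ℕ.^ e)          ≈⟨ ^-fixed x^m≈x e ⟩
    x                      ∎

  ∣⇒·≈0 : ∀ {p} → p · 1# ≈ 0# → ∀ {n} → p ∣ n → ∀ x → n · x ≈ 0#
  ∣⇒·≈0 {p} p·1≈0 (divides m ≡.refl) x = begin
    (m ℕ.* p) · x            ≈⟨ ×-congʳ (m ℕ.* p) (*-identityˡ x) ⟨
    (m ℕ.* p) · (1# * x)     ≈⟨ ×-assoc-* (m ℕ.* p) 1# x ⟨
    (m ℕ.* p) · 1# * x       ≈⟨ *-congʳ (×1-homo-* m p) ⟩
    m · 1# * (p · 1#) * x    ≈⟨ *-congʳ (*-congˡ p·1≈0) ⟩
    m · 1# * 0# * x          ≈⟨ *-congʳ (zeroʳ _) ⟩
    0# * x                   ≈⟨ zeroˡ x ⟩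
    0#                       ∎

  -- All binomial coefficients but the two outer ones are divisible by p, so the binomial sum is cut
  -- at both ends and its middle vanishes.
  frobenius : ∀ {p} → Prime p → p · 1# ≈ 0# → AdditivePower p
  frobenius {suc n} p-prime p·1≈0 x y = begin
    (x + y) ^ suc n
      ≈⟨ binomial-theorem (suc n) x y ⟩
    term Fin.zero + sum (λ k → term (Fin.suc k))
      ≈⟨ +-congˡ (sum-init-last (λ k → term (Fin.suc k))) ⟩
    term Fin.zero + (sum (λ k → term (Fin.suc (Fin.inject₁ k))) + term (Fin.fromℕ (suc n)))
      ≈⟨ +-cong first (+-cong middle last) ⟩
    y ^ suc n + (0# + x ^ suc n)
      ≈⟨ solve 2 (λ x y → y :+ (con 0 :+ x) := x :+ y) refl _ _ ⟩
    x ^ suc n + y ^ suc n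
      ∎
    where
    term = binomialTerm x y (suc n)

    first : term Fin.zero ≈ y ^ suc n
    first = trans (×-homo-1 _) (*-identityˡ _)

    middle : sum (λ k → term (Fin.suc (Fin.inject₁ k))) ≈ 0#
    middle = trans (sum-cong-≋ {n} λ k → ∣⇒·≈0 p·1≈0 (prime∣C p-prime (inject₁<n k)) _) (sum-replicate-zero n)
      where
      inject₁<n : ∀ (k : Fin n) → Fin.toℕ (Fin.inject₁ k) < n
      inject₁<n k = ≡.subst (_< n) (≡.sym (toℕ-inject₁ k)) (toℕ<n k)

    last : term (Fin.fromℕ (suc n)) ≈ x ^ suc n
    last rewrite toℕ-fromℕ n | nCn≡1 (suc n) | ℕ.n∸n≡0 n =
      trans (×-homo-1 _) (*-identityʳ _)

  shiftedProduct : Carrier → List Carrier → Carrier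
  shiftedProduct a []       = 1#
  shiftedProduct a (y ∷ ys) = (y + a) * shiftedProduct a ys

  total : List Carrier → Carrier
  total []       = 0#
  total (y ∷ ys) = y + total ys

  -- As a is fixed by the additive map of raising to the power q, each factor x^(q^e) + a is (x +
  -- a)^(q^e), and the exponents add up.
  shiftedProduct-powers : ∀ {q a} → AdditivePower q → a ^ q ≈ a → ∀ {A : Set} (e : A → ℕ) x is →
    shiftedProduct a (List.map (λ i → x ^ (q ℕ.^ e i)) is) ≈ (x + a) ^ sumₙ (List.map (λ i → q ℕ.^ e i) is)
  shiftedProduct-powers q-add a^q≈a e x [] = refl
  shiftedProduct-powers {q} {a} q-add a^q≈a e x (i ∷ is) = begin
    (x ^ m + a) * shiftedProduct a (List.map (λ i → x ^ (q ℕ.^ e i)) is)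
      ≈⟨ *-cong (+-congˡ (sym (^-fixed a^q≈a (e i)))) (shiftedProduct-powers q-add a^q≈a e x is) ⟩
    (x ^ m + a ^ m) * (x + a) ^ S
      ≈⟨ *-congʳ (additivePower-^ q-add (e i) x a) ⟨
    (x + a) ^ m * (x + a) ^ S
      ≈⟨ ^-homo-* (x + a) m S ⟨
    (x + a) ^ (m ℕ.+ S)
      ∎
    where
    m = q ℕ.^ e i
    S = sumₙ (List.map (λ i → q ℕ.^ e i) is)

  total-powers-scaled : ∀ {A : Set} (e : A → ℕ) {a b} → (∀ i → a ^ e i ≈ b) → ∀ x is →
    total (List.map (λ i → (a * x) ^ e i) is) ≈ b * total (List.map (λ i → x ^ e i) is)
  total-powers-scaled e {b = b} a^e≈b x [] = sym (zeroʳ b)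
  total-powers-scaled e {a} {b} a^e≈b x (i ∷ is) = begin
    (a * x) ^ e i + total (List.map (λ i → (a * x) ^ e i) is)
      ≈⟨ +-cong (trans (^-distrib-* a x (e i)) (*-congʳ (a^e≈b i))) (total-powers-scaled e a^e≈b x is) ⟩
    b * x ^ e i + b * total (List.map (λ i → x ^ e i) is)
      ≈⟨ distribˡ b _ _ ⟨
    b * (x ^ e i + total (List.map (λ i → x ^ e i) is))
      ∎

  module WeightedSums {m : ℕ} (as : Vector Carrier m) where

    powerSum : ℕ → Carrier
    powerSum w = sum (λ i → as i ^ w)

    weightedSum : ℕ → List Carrier → Carrier
    weightedSum w ys = sum (λ i → as i ^ w * shiftedProduct (as i) ys)

    weightedSum-[] : ∀ w → weightedSum w [] ≈ powerSum w
    weightedSum-[] w = sum-cong-≋ (λ i → *-identityʳ (as i ^ w))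

    -- Expanding y + a: the first part lowers the degree w + `length` of the summand as a polynomial
    -- in a, the second keeps the degree and moves one factor into the weight.
    weightedSum-∷ : ∀ w y ys →
      weightedSum w (y ∷ ys) ≈ y * weightedSum w ys + weightedSum (suc w) ys
    weightedSum-∷ w y ys = begin
      sum (λ i → as i ^ w * ((y + as i) * s i))                 ≈⟨ sum-cong-≋ (λ i → solve 4 (λ p y a s → p :* ((y :+ a) :* s) := y :* (p :* s) :+ (a :* p) :* s) refl (as i ^ w) y (as i) (s i)) ⟩
      sum (λ i → y * (as i ^ w * s i) + as i ^ suc w * s i)     ≈⟨ ∑-distrib-+ {m} (λ i → y * (as i ^ w * s i)) (λ i → as i ^ suc w * s i) ⟩
      sum (λ i → y * (as i ^ w * s i)) + weightedSum (suc w) ys ≈⟨ +-congʳ (*-distribˡ-sum {m} y (λ i → as i ^ w * s i)) ⟨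
      y * weightedSum w ys + weightedSum (suc w) ys             ∎
      where
      s : Vector Carrier m
      s i = shiftedProduct (as i) ys

    module _ {n : ℕ} {ν : Carrier}
             (powerSum-< : ∀ {w} → w < n → powerSum w ≈ 0#) (powerSum-n : powerSum n ≈ ν) where

      -- The summand has degree w + `length ys` in a, so only power sums with exponent below n
      -- occur.
      weightedSum-< : ∀ w ys → w ℕ.+ length ys < n → weightedSum w ys ≈ 0#
      weightedSum-< w [] w<n =
        trans (weightedSum-[] w) (powerSum-< (≡.subst (_< n) (ℕ.+-identityʳ w) w<n))
      weightedSum-< w (y ∷ ys) w+l<n = begin
        weightedSum w (y ∷ ys)                          ≈⟨ weightedSum-∷ w y ys ⟩
        y * weightedSum w ys + weightedSum (suc w) ys   ≈⟨ +-cong (*-congˡ (weightedSum-< w ys (ℕ.<⇒≤ suc-w+l<n))) (weightedSum-< (suc w) ys suc-w+l<n) ⟩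
        y * 0# + 0#                                     ≈⟨ solve 1 (λ y → y :* con 0 :+ con 0 := con 0) refl y ⟩
        0#                                              ∎
        where suc-w+l<n = ≡.subst (_< n) (ℕ.+-suc w (length ys)) w+l<n

      -- The summand is monic of degree n in a, and only its leading power contributes.
      weightedSum-≡ : ∀ w ys → w ℕ.+ length ys ≡ n → weightedSum w ys ≈ ν
      weightedSum-≡ w [] w≡n =
        trans (weightedSum-[] w) (trans (reflexive (≡.cong powerSum (≡.trans (≡.sym (ℕ.+-identityʳ w)) w≡n))) powerSum-n)
      weightedSum-≡ w (y ∷ ys) w+l≡n = begin
        weightedSum w (y ∷ ys)                          ≈⟨ weightedSum-∷ w y ys ⟩
        y * weightedSum w ys + weightedSum (suc w) ys   ≈⟨ +-cong (*-congˡ (weightedSum-< w ys (ℕ.≤-reflexive suc-w+l≡n))) (weightedSum-≡ (suc w) ys suc-w+l≡n) ⟩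
        y * 0# + ν                                      ≈⟨ solve 2 (λ y ν → y :* con 0 :+ ν := ν) refl y ν ⟩
        ν                                               ∎
        where suc-w+l≡n = ≡.trans (≡.sym (ℕ.+-suc w (length ys))) w+l≡n

      -- In degree n + 1 two powers of a can contribute: the leading one, and the n-th, whose
      -- coefficient is the sum of `ys`. All products of two or more entries of `ys` disappear,
      -- which leaves an expression linear in them up to a constant.
      weightedSum-suc : ∀ w ys → w ℕ.+ length ys ≡ suc n →
        weightedSum w ys ≈ ν * total ys + powerSum (suc n)
      weightedSum-suc w [] w≡1+n = begin
        weightedSum w []              ≈⟨ weightedSum-[] w ⟩
        powerSum w                    ≈⟨ reflexive (≡.cong powerSum (≡.trans (≡.sym (ℕ.+-identityʳ w)) w≡1+n)) ⟩
        powerSum (suc n)              ≈⟨ solve 2 (λ ν p → p := ν :* con 0 :+ p) refl ν _ ⟩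
        ν * 0# + powerSum (suc n)     ∎
      weightedSum-suc w (y ∷ ys) w+l≡1+n = begin
        weightedSum w (y ∷ ys)                           ≈⟨ weightedSum-∷ w y ys ⟩
        y * weightedSum w ys + weightedSum (suc w) ys    ≈⟨ +-cong (*-congˡ (weightedSum-≡ w ys (ℕ.suc-injective suc-w+l≡1+n))) (weightedSum-suc (suc w) ys suc-w+l≡1+n) ⟩
        y * ν + (ν * total ys + powerSum (suc n))        ≈⟨ solve 4 (λ y ν t p → y :* ν :+ (ν :* t :+ p) := ν :* (y :+ t) :+ p) refl y ν _ _ ⟩
        ν * total (y ∷ ys) + powerSum (suc n)            ∎
        where suc-w+l≡1+n = ≡.trans (≡.sym (ℕ.+-suc w (length ys))) w+l≡1+n

-- Roots of monic polynomials over an algebraically closed field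

module Roots {c ℓ₁ ℓ₂ : Level} (F : HeytingField c ℓ₁ ℓ₂) (closed : AlgebraicallyClosed F) where

  open Polynomials F using (𝔽; _+ₚ_; coeff-+)
  open CommutativeRing 𝔽 hiding (zero)
  open RingIdentities 𝔽
  open SetoidReasoning setoid
  open NaturalSolver commutativeSemiring using (solve; con; _:+_; _:*_; _:=_)
  open import Algebra.Properties.Semiring.Exp semiring
  open import Algebra.Properties.Semiring.Mult semiring renaming (_×_ to _·_)
  open import Algebra.Properties.CommutativeMonoid.Mult +-commutativeMonoid using (×-distrib-+)
  open import Algebra.Properties.Semiring.Sum semiring
  open import Algebra.Properties.Ring ring using (-‿distribˡ-*; -‿distribʳ-*; -‿involutive; -0#≈0#; -‿+-comm)
  open import Algebra.Properties.Group +-group using (inverseˡ-unique; inverseʳ-unique)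

  VanishesFrom : ℕ → (ℕ → Carrier) → Set ℓ₁
  VanishesFrom n f = ∀ {m} → n ≤ m → f m ≈ 0#

  Monic : Poly F → ℕ → Set ℓ₁
  Monic f n = coeff F f n ≈ 1# × VanishesFrom (suc n) (coeff F f)

  -- Apartness from 0 comes from invertibility, and 1 is its own inverse. Roots are taken of monic
  -- polynomials only, so apartness never has to be decided.
  monic⇒hasDegree : ∀ {f n} → Monic f n → HasDegree F f n
  monic⇒hasDegree {f} {n} (fₙ≈1 , f>n≈0) =
    HeytingField.invertible⇒# F (1# , trans (*-identityˡ _) fₙ-0≈1 , trans (*-identityʳ _) fₙ-0≈1) , f>n≈0
    where
    fₙ-0≈1 : coeff F f n - 0# ≈ 1#
    fₙ-0≈1 = trans (+-cong fₙ≈1 -0#≈0#) (+-identityʳ 1#)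

  monic⇒root : ∀ {f n} → Monic f n → 1 ≤ n → ∃[ x ] eval F f x ≈ 0#
  monic⇒root {f} f-monic 1≤n = closed f (monic⇒hasDegree {f} f-monic) 1≤n

  monomial : ℕ → Poly F
  monomial zero    = 1# ∷ []
  monomial (suc n) = 0# ∷ monomial n

  coeff-monomial-≡ : ∀ n → coeff F (monomial n) n ≈ 1#
  coeff-monomial-≡ zero    = refl
  coeff-monomial-≡ (suc n) = coeff-monomial-≡ n

  coeff-monomial-≢ : ∀ {n m} → m ≢ n → coeff F (monomial n) m ≈ 0#
  coeff-monomial-≢ {zero}  {zero}  m≢n = ⊥-elim (m≢n ≡.refl)
  coeff-monomial-≢ {zero}  {suc m} m≢n = refl
  coeff-monomial-≢ {suc n} {zero}  m≢n = refl
  coeff-monomial-≢ {suc n} {suc m} m≢n = coeff-monomial-≢ (λ m≡n → m≢n (≡.cong suc m≡n))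

  +-monomial-monic : ∀ g n → VanishesFrom n (coeff F g) → Monic (g +ₚ monomial n) n
  +-monomial-monic g n g≥n≈0 =
    trans (coeff-+ g (monomial n) n) (trans (+-cong (g≥n≈0 ℕ.≤-refl) (coeff-monomial-≡ n)) (+-identityˡ 1#)) ,
    λ {m} n<m → trans (coeff-+ g (monomial n) m)
      (trans (+-cong (g≥n≈0 (ℕ.<⇒≤ n<m)) (coeff-monomial-≢ (≡.≢-sym (ℕ.<⇒≢ n<m)))) (+-identityˡ 0#))

  eval-+ : ∀ f g x → eval F (f +ₚ g) x ≈ eval F f x + eval F g x
  eval-+ []      g       x = sym (+-identityˡ _)
  eval-+ (a ∷ f) []      x = sym (+-identityʳ _)
  eval-+ (a ∷ f) (b ∷ g) x = trans (+-congˡ (*-congˡ (eval-+ f g x)))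
    (solve 5 (λ a b x y z → (a :+ b) :+ x :* (y :+ z) := (a :+ x :* y) :+ (b :+ x :* z)) refl a b x _ _)

  eval-monomial : ∀ n x → eval F (monomial n) x ≈ x ^ n
  eval-monomial zero    x = trans (+-congˡ (zeroʳ x)) (+-identityʳ 1#)
  eval-monomial (suc n) x = trans (+-identityˡ _) (*-congˡ (eval-monomial n x))

  eval-+-monomial : ∀ g n x → eval F (g +ₚ monomial n) x ≈ eval F g x + x ^ n
  eval-+-monomial g n x = trans (eval-+ g (monomial n) x) (+-congˡ (eval-monomial n x))

  eval-const : ∀ a x → eval F (a ∷ []) x ≈ a
  eval-const a x = trans (+-congˡ (zeroʳ x)) (+-identityʳ a)

  nthRoot : ∀ k → 1 ≤ k → ∀ a → ∃[ x ] x ^ k ≈ a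
  nthRoot k@(suc _) 1≤k a = x , (begin
    x ^ k      ≈⟨ inverseʳ-unique (- a) (x ^ k) -a+x^k≈0 ⟩
    - (- a)    ≈⟨ -‿involutive a ⟩
    a          ∎)
    where
    low : VanishesFrom k (coeff F (- a ∷ []))
    low (s≤s _) = refl
    root = monic⇒root {(- a ∷ []) +ₚ monomial k} (+-monomial-monic (- a ∷ []) k low) 1≤k
    x = proj₁ root
    -a+x^k≈0 : - a + x ^ k ≈ 0#
    -a+x^k≈0 = trans (+-congʳ (sym (eval-const (- a) x))) (trans (sym (eval-+-monomial (- a ∷ []) k x)) (proj₂ root))

  -- Below, a sequence ℕ → Carrier of coefficients stands for a polynomial, and X+ b ∙ f for (X + b) f.

  X+_∙_ : Carrier → (ℕ → Carrier) → ℕ → Carrier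
  (X+ b ∙ f) zero    = b * f zero
  (X+ b ∙ f) (suc m) = f m + b * f (suc m)

  X+-cong : ∀ b {f g : ℕ → Carrier} → (∀ m → f m ≈ g m) → ∀ m → (X+ b ∙ f) m ≈ (X+ b ∙ g) m
  X+-cong b f≈g zero    = *-congˡ (f≈g zero)
  X+-cong b f≈g (suc m) = +-cong (f≈g m) (*-congˡ (f≈g (suc m)))

  X+-comm : ∀ a b f m → (X+ a ∙ (X+ b ∙ f)) m ≈ (X+ b ∙ (X+ a ∙ f)) m
  X+-comm a b f zero          = solve 3 (λ a b x → a :* (b :* x) := b :* (a :* x)) refl a b _
  X+-comm a b f (suc zero)    =
    solve 4 (λ a b x y → b :* x :+ a :* (x :+ b :* y) := a :* x :+ b :* (x :+ a :* y)) refl a b _ _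
  X+-comm a b f (suc (suc m)) =
    solve 5 (λ a b x y z → (x :+ b :* y) :+ a :* (y :+ b :* z) := (x :+ a :* y) :+ b :* (y :+ a :* z)) refl a b _ _ _

  X+-vanishesFrom : ∀ b {f n} → VanishesFrom n f → VanishesFrom (suc n) (X+ b ∙ f)
  X+-vanishesFrom b f≥n≈0 {suc m} (s≤s n≤m) =
    trans (+-cong (f≥n≈0 n≤m) (*-congˡ (f≥n≈0 (ℕ.m≤n⇒m≤1+n n≤m))))
      (trans (+-identityˡ _) (zeroʳ b))

  linearProduct : ∀ {n} → Vector Carrier n → ℕ → Carrier
  linearProduct {zero}  bs zero    = 1#
  linearProduct {zero}  bs (suc m) = 0#
  linearProduct {suc n} bs         = X+ Vector.head bs ∙ linearProduct (Vector.tail bs)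

  cofactor : ∀ {n} → Vector Carrier n → Fin n → ℕ → Carrier
  cofactor bs Fin.zero    = linearProduct (Vector.tail bs)
  cofactor bs (Fin.suc i) = X+ Vector.head bs ∙ cofactor (Vector.tail bs) i

  X+-cofactor : ∀ {n} (bs : Vector Carrier n) i m →
    (X+ bs i ∙ cofactor bs i) m ≈ linearProduct bs m
  X+-cofactor bs Fin.zero    m = refl
  X+-cofactor bs (Fin.suc i) m = trans (X+-comm (bs (Fin.suc i)) (Vector.head bs) _ m)
    (X+-cong (Vector.head bs) (X+-cofactor (Vector.tail bs) i) m)

  linearProduct-vanishesFrom : ∀ {n} (bs : Vector Carrier n) → VanishesFrom (suc n) (linearProduct bs)
  linearProduct-vanishesFrom {zero}  bs (s≤s _) = refl
  linearProduct-vanishesFrom {suc n} bs =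
    X+-vanishesFrom (Vector.head bs) (linearProduct-vanishesFrom (Vector.tail bs))

  cofactor-vanishesFrom : ∀ {n} (bs : Vector Carrier n) i → VanishesFrom n (cofactor bs i)
  cofactor-vanishesFrom bs Fin.zero    = linearProduct-vanishesFrom (Vector.tail bs)
  cofactor-vanishesFrom bs (Fin.suc i) =
    X+-vanishesFrom (Vector.head bs) (cofactor-vanishesFrom (Vector.tail bs) i)

  n·0≈0 : ∀ n → n · 0# ≈ 0#
  n·0≈0 zero    = refl
  n·0≈0 (suc n) = trans (+-identityˡ _) (n·0≈0 n)

  -- The derivative of a product of linear factors is the sum of its cofactors.
  sum-cofactor : ∀ {n} (bs : Vector Carrier n) m →
    sum (λ i → cofactor bs i m) ≈ suc m · linearProduct bs (suc m)
  sum-cofactor {zero}  bs m = sym (n·0≈0 (suc m))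
  sum-cofactor {suc n} bs zero = begin
    P 0 + sum (λ i → b * C i 0)              ≈⟨ +-congˡ (*-distribˡ-sum b (λ i → C i 0)) ⟨
    P 0 + b * sum (λ i → C i 0)              ≈⟨ +-congˡ (*-congˡ (sum-cofactor (Vector.tail bs) 0)) ⟩
    P 0 + b * (1 · P 1)                      ≈⟨ solve 3 (λ p b q → p :+ b :* (q :+ con 0) := (p :+ b :* q) :+ con 0) refl _ b _ ⟩
    1 · (P 0 + b * P 1)                      ∎
    where
    b = Vector.head bs
    P = linearProduct (Vector.tail bs)
    C = cofactor (Vector.tail bs)
  sum-cofactor {suc n} bs (suc m) = begin
    P (suc m) + sum (λ i → C i m + b * C i (suc m))
      ≈⟨ +-congˡ (∑-distrib-+ (λ i → C i m) (λ i → b * C i (suc m))) ⟩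
    P (suc m) + (sum (λ i → C i m) + sum (λ i → b * C i (suc m)))
      ≈⟨ +-congˡ (+-congˡ (*-distribˡ-sum b (λ i → C i (suc m)))) ⟨
    P (suc m) + (sum (λ i → C i m) + b * sum (λ i → C i (suc m)))
      ≈⟨ +-congˡ (+-cong (sum-cofactor (Vector.tail bs) m) (*-congˡ (sum-cofactor (Vector.tail bs) (suc m)))) ⟩
    P (suc m) + (suc m · P (suc m) + b * (suc (suc m) · P (suc (suc m))))
      ≈⟨ +-assoc _ _ _ ⟨
    suc (suc m) · P (suc m) + b * (suc (suc m) · P (suc (suc m)))
      ≈⟨ +-congˡ (×-comm-* (suc (suc m)) b _) ⟩
    suc (suc m) · P (suc m) + suc (suc m) · (b * P (suc (suc m)))
      ≈⟨ ×-distrib-+ _ _ (suc (suc m)) ⟨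
    suc (suc m) · (P (suc m) + b * P (suc (suc m)))
      ∎
    where
    b = Vector.head bs
    P = linearProduct (Vector.tail bs)
    C = cofactor (Vector.tail bs)

  -- Horner's scheme: the partial results of evaluating f at x are the coefficients of the quotient
  -- of f by X - x. The last entry is always 0, so the list keeps its length.
  quotient : Poly F → Carrier → Poly F
  quotient []      x = []
  quotient (a ∷ f) x = eval F f x ∷ quotient f x

  eval-quotient : ∀ f x → eval F f x ≈ coeff F f 0 + x * coeff F (quotient f x) 0
  eval-quotient []      x = solve 1 (λ x → con 0 := con 0 :+ x :* con 0) refl x
  eval-quotient (a ∷ f) x = refl

  coeff-quotient : ∀ f x m →
    coeff F (quotient f x) m ≈ coeff F f (suc m) + x * coeff F (quotient f x) (suc m)
  coeff-quotient []      x m       = eval-quotient [] x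
  coeff-quotient (a ∷ f) x zero    = eval-quotient f x
  coeff-quotient (a ∷ f) x (suc m) = coeff-quotient f x m

  eval-vanishing : ∀ f x → VanishesFrom 0 (coeff F f) → eval F f x ≈ 0#
  eval-vanishing []      x f≈0 = refl
  eval-vanishing (a ∷ f) x f≈0 = begin
    a + x * eval F f x   ≈⟨ +-cong (f≈0 {0} z≤n) (*-congˡ (eval-vanishing f x (λ {m} _ → f≈0 {suc m} z≤n))) ⟩
    0# + x * 0#          ≈⟨ solve 1 (λ x → con 0 :+ x :* con 0 := con 0) refl x ⟩
    0#                   ∎

  -- The coefficient at m is the value at x of the part of f from degree m + 1 on, and for m at
  -- least n that part has only zero coefficients.
  quotient-vanishesFrom : ∀ f x {n} →
    VanishesFrom (suc n) (coeff F f) → VanishesFrom n (coeff F (quotient f x))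
  quotient-vanishesFrom []      x         f>n≈0 n≤m = refl
  quotient-vanishesFrom (a ∷ f) x {zero}  f>n≈0 {zero}  z≤n =
    eval-vanishing f x (λ {m} _ → f>n≈0 {suc m} (s≤s z≤n))
  quotient-vanishesFrom (a ∷ f) x {zero}  f>n≈0 {suc m} z≤n =
    quotient-vanishesFrom f x {zero} (λ {m} 1≤m → f>n≈0 {suc m} (s≤s z≤n)) z≤n
  quotient-vanishesFrom (a ∷ f) x {suc n} f>n≈0 {suc m} (s≤s n≤m) =
    quotient-vanishesFrom f x (λ {m} n<m → f>n≈0 {suc m} (s≤s n<m)) n≤m

  x+z≈y⇒-z+y≈x : ∀ {x y z} → x + z ≈ y → y + - z ≈ x
  x+z≈y⇒-z+y≈x {x} {y} {z} x+z≈y = begin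
    y + - z          ≈⟨ +-congʳ x+z≈y ⟨
    x + z + - z      ≈⟨ +-assoc x z (- z) ⟩
    x + (z + - z)    ≈⟨ +-congˡ (-‿inverseʳ z) ⟩
    x + 0#           ≈⟨ +-identityʳ x ⟩
    x                ∎

  -- Horner's recursion solved for the coefficients of f; in degree 0 the remainder is the value at
  -- x, which vanishes.
  X+-quotient : ∀ f x → eval F f x ≈ 0# → ∀ m →
    coeff F f m ≈ (X+ (- x) ∙ coeff F (quotient f x)) m
  X+-quotient f x fx≈0 zero = begin
    coeff F f 0                        ≈⟨ inverseˡ-unique _ _ (trans (sym (eval-quotient f x)) fx≈0) ⟩
    - (x * coeff F (quotient f x) 0)   ≈⟨ -‿distribˡ-* _ _ ⟩
    - x * coeff F (quotient f x) 0     ∎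
  X+-quotient f x fx≈0 (suc m) = begin
    coeff F f (suc m)
      ≈⟨ x+z≈y⇒-z+y≈x (sym (coeff-quotient f x m)) ⟨
    coeff F (quotient f x) m + - (x * coeff F (quotient f x) (suc m))
      ≈⟨ +-congˡ (-‿distribˡ-* _ _) ⟩
    coeff F (quotient f x) m + - x * coeff F (quotient f x) (suc m)
      ∎

  splits : ∀ n f → Monic f n → ∃[ bs ] (∀ m → coeff F f m ≈ linearProduct {n} bs m)
  splits zero    f (f₀≈1 , f>0≈0) = (λ ()) , λ where
    zero    → f₀≈1
    (suc m) → f>0≈0 (s≤s z≤n)
  -- Linear factors are written X + b, so a root x enters as b = - x; the quotient inherits the
  -- leading coefficient 1.
  splits (suc n) f f-monic@(fₙ≈1 , f>n≈0) = (- x) Vector.∷ proj₁ rest , λ m →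
    trans (X+-quotient f x (proj₂ root) m) (X+-cong (- x) (proj₂ rest) m)
    where
    root = monic⇒root {f} f-monic (s≤s z≤n)
    x = proj₁ root
    q≥n≈0 = quotient-vanishesFrom f x f>n≈0
    rest = splits n (quotient f x)
      ( (begin
          coeff F (quotient f x) n                                  ≈⟨ coeff-quotient f x n ⟩
          coeff F f (suc n) + x * coeff F (quotient f x) (suc n)    ≈⟨ +-cong fₙ≈1 (*-congˡ (q≥n≈0 ℕ.≤-refl)) ⟩
          1# + x * 0#                                               ≈⟨ solve 2 (λ o x → o :+ x :* con 0 := o) refl 1# x ⟩
          1#                                                        ∎)
      , q≥n≈0 )

  -- Roots of unity and their power sums

  record RootsOfUnity (n : ℕ) : Set (c ⊔ ℓ₁) where
    field
      root       : Vector Carrier n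
      root^n≈1   : ∀ i → root i ^ n ≈ 1#
      powerSum-0 : sum (λ i → root i ^ 0) ≈ n · 1#
      powerSum-< : ∀ {j} → 1 ≤ j → j < n → sum (λ i → root i ^ j) ≈ 0#
      powerSum-n : sum (λ i → root i ^ n) ≈ n · 1#

  -- Over all roots ζ of X^n - 1, counted with multiplicity, the quotients of X^n - 1 by X - ζ add
  -- up to the derivative n X^(n-1). The coefficient of X^(n-1-j) in such a quotient is ζ^j, so
  -- comparing coefficients yields the power sums without any appeal to distinctness of the roots.
  rootsOfUnity : ∀ n → 1 ≤ n → RootsOfUnity n
  rootsOfUnity n@(suc n′) 1≤n = record
    { root       = root
    ; root^n≈1   = root^n≈1
    ; powerSum-0 = sum-replicate n
    ; powerSum-< = powerSum-<
    ; powerSum-n = trans (sum-cong-≋ root^n≈1) (sum-replicate n)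
    }
    where
    f = (- 1# ∷ []) +ₚ monomial n

    f-low : VanishesFrom n (coeff F (- 1# ∷ []))
    f-low (s≤s _) = refl

    f-splits = splits n f (+-monomial-monic (- 1# ∷ []) n f-low)
    bs = proj₁ f-splits

    root : Vector Carrier n
    root i = - bs i

    f-middle : ∀ {m} → suc m ≢ n → coeff F f (suc m) ≈ 0#
    f-middle {m} m≢n =
      trans (coeff-+ (- 1# ∷ []) (monomial n) (suc m)) (trans (+-identityˡ _) (coeff-monomial-≢ {n} m≢n))

    f-lead : coeff F f n ≈ 1#
    f-lead = proj₁ (+-monomial-monic (- 1# ∷ []) n f-low)

    product-step : ∀ i m → coeff F f (suc m) + root i * cofactor bs i (suc m) ≈ cofactor bs i m
    product-step i m = begin
      coeff F f (suc m) + - bs i * h (suc m)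
        ≈⟨ +-cong (trans (proj₂ f-splits (suc m)) (sym (X+-cofactor bs i (suc m)))) (sym (-‿distribˡ-* _ _)) ⟩
      (h m + bs i * h (suc m)) + - (bs i * h (suc m))
        ≈⟨ x+z≈y⇒-z+y≈x refl ⟩
      h m
        ∎
      where h = cofactor bs i

    -- A recursion downwards from the leading coefficient 1: the coefficients of X^n - 1 strictly
    -- between degrees 0 and n vanish, so each step multiplies by the root.
    cofactor≈power : ∀ i j m → m ℕ.+ suc j ≡ n → cofactor bs i m ≈ root i ^ j
    cofactor≈power i zero m m+1≡n = begin
      cofactor bs i m                                        ≈⟨ product-step i m ⟨
      coeff F f (suc m) + root i * cofactor bs i (suc m)     ≈⟨ +-cong (trans (reflexive (≡.cong (coeff F f) 1+m≡n)) f-lead)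
                                                                      (*-congˡ (cofactor-vanishesFrom bs i (ℕ.≤-reflexive (≡.sym 1+m≡n)))) ⟩
      1# + root i * 0#                                       ≈⟨ trans (+-congˡ (zeroʳ _)) (+-identityʳ 1#) ⟩
      1#                                                     ∎
      where
      1+m≡n : suc m ≡ n
      1+m≡n = ≡.trans (ℕ.+-comm 1 m) m+1≡n
    cofactor≈power i (suc j) m m+2+j≡n = begin
      cofactor bs i m                                        ≈⟨ product-step i m ⟨
      coeff F f (suc m) + root i * cofactor bs i (suc m)     ≈⟨ +-cong (f-middle (λ 1+m≡n → ℕ.m+1+n≢m (suc m) (≡.trans 1+m+1+j≡n (≡.sym 1+m≡n))))
                                                                      (*-congˡ (cofactor≈power i j (suc m) 1+m+1+j≡n)) ⟩
      0# + root i * root i ^ j                               ≈⟨ +-identityˡ _ ⟩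
      root i ^ suc j                                         ∎
      where
      1+m+1+j≡n : suc m ℕ.+ suc j ≡ n
      1+m+1+j≡n = ≡.trans (≡.sym (ℕ.+-suc m (suc j))) m+2+j≡n

    root^n≈1 : ∀ i → root i ^ n ≈ 1#
    root^n≈1 i = begin
      -- The constant coefficient of the cofactor is the power n - 1 of the root, and its product
      -- with `bs i` is the constant coefficient of X^n - 1, which computes to - 1 + 0.
      root i * root i ^ n′             ≈⟨ *-congˡ (cofactor≈power i n′ 0 ≡.refl) ⟨
      - bs i * cofactor bs i 0         ≈⟨ -‿distribˡ-* _ _ ⟨
      - (bs i * cofactor bs i 0)       ≈⟨ -‿cong (trans (X+-cofactor bs i 0) (sym (proj₂ f-splits 0))) ⟩
      - (- 1# + 0#)                    ≈⟨ -‿cong (+-identityʳ _) ⟩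
      - - 1#                           ≈⟨ -‿involutive 1# ⟩
      1#                               ∎

    powerSum-< : ∀ {j} → 1 ≤ j → j < n → sum (λ i → root i ^ j) ≈ 0#
    powerSum-< {j} 1≤j j<n = begin
      sum (λ i → root i ^ j)                     ≈⟨ sum-cong-≋ (λ i → cofactor≈power i j m m+1+j≡n) ⟨
      sum (λ i → cofactor bs i m)                ≈⟨ sum-cofactor bs m ⟩
      suc m · linearProduct bs (suc m)           ≈⟨ ×-congʳ (suc m) (trans (sym (proj₂ f-splits (suc m))) (f-middle 1+m≢n)) ⟩
      suc m · 0#                                 ≈⟨ n·0≈0 (suc m) ⟩
      0#                                         ∎
      where
      -- The degree at which the cofactors have the j-th powers as coefficients; since j is
      -- positive, m + 1 stays below n, where X^n - 1 has no term.
      m = n ℕ.∸ suc j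
      m+1+j≡n = ℕ.m∸n+n≡m j<n
      1+m≢n : suc m ≢ n
      1+m≢n 1+m≡n = ℕ.<⇒≢ (ℕ.≤-trans (s≤s 1≤j) (ℕ.≤-refl))
        (ℕ.+-cancelˡ-≡ m 1 (suc j) (≡.trans (≡.trans (ℕ.+-comm m 1) 1+m≡n) (≡.sym m+1+j≡n)))

  -- For n = q - 1 and q a power of the characteristic, these are the elements of F_q.
  0∷rootsOfUnity : ∀ {n} → RootsOfUnity n → Vector Carrier (suc n)
  0∷rootsOfUnity μ = 0# Vector.∷ RootsOfUnity.root μ

  module _ {n : ℕ} (μ : RootsOfUnity n) where

    open RootsOfUnity μ
    open WeightedSums (0∷rootsOfUnity μ) using (powerSum)

    0∷rootsOfUnity-fixed : ∀ i → 0∷rootsOfUnity μ i ^ suc n ≈ 0∷rootsOfUnity μ i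
    0∷rootsOfUnity-fixed Fin.zero    = zeroˡ _
    0∷rootsOfUnity-fixed (Fin.suc i) = trans (*-congˡ (root^n≈1 i)) (*-identityʳ _)

    0∷rootsOfUnity-powerSum-< : suc n · 1# ≈ 0# → ∀ {w} → w < n → powerSum w ≈ 0#
    -- Here 0^0 = 1, so the sum counts all q points.
    0∷rootsOfUnity-powerSum-< q·1≈0 {zero}  w<n = trans (+-congˡ powerSum-0) q·1≈0
    0∷rootsOfUnity-powerSum-< q·1≈0 {suc w} w<n =
      trans (+-cong (zeroˡ _) (powerSum-< (s≤s z≤n) w<n)) (+-identityˡ 0#)

    -- The point 0 contributes nothing because n is positive, and every root of unity contributes 1,
    -- which makes q - 1 = - 1.
    0∷rootsOfUnity-powerSum-n : 1 ≤ n → suc n · 1# ≈ 0# → powerSum n ≈ - 1#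
    0∷rootsOfUnity-powerSum-n 1≤n@(s≤s _) q·1≈0 = begin
      0# ^ n + sum (λ i → root i ^ n)   ≈⟨ +-cong (zeroˡ _) powerSum-n ⟩
      0# + n · 1#                       ≈⟨ +-identityˡ _ ⟩
      n · 1#                            ≈⟨ inverseʳ-unique 1# _ q·1≈0 ⟩
      - 1#                              ∎

  -- tracePoly q m is (Y + Y^q + ⋯ + Y^(q^(m-1))) / Y.
  tracePoly : ℕ → ℕ → Poly F
  tracePoly q zero    = []
  tracePoly q (suc m) = tracePoly q m +ₚ monomial (q ℕ.^ m ℕ.∸ 1)

  -- Traces and Artin-Schreier equations

  module _ {q : ℕ} (1<q : 1 < q) where

    private instance
      q-nonZero : ℕ.NonZero q
      q-nonZero = ℕ.>-nonZero (ℕ.<⇒≤ 1<q)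

    q^m<q^1+m : ∀ m → q ℕ.^ m < q ℕ.^ suc m
    q^m<q^1+m m = ℕ.^-monoʳ-< q 1<q (ℕ.n<1+n m)

    tracePoly-monic : ∀ m → Monic (tracePoly q (suc m)) (q ℕ.^ m ℕ.∸ 1)
    tracePoly-monic zero    = +-monomial-monic [] 0 (λ _ → refl)
    tracePoly-monic (suc m) = +-monomial-monic (tracePoly q (suc m)) _
      (λ d≤l → proj₂ (tracePoly-monic m) (ℕ.≤-trans (ℕ.∸-monoˡ-< (q^m<q^1+m m) (ℕ.m^n>0 q m)) d≤l))

    -- The formula for the trace from F_{q^m} to F_q, taken at arbitrary elements.
    trace : ℕ → Carrier → Carrier
    trace zero    y = 0#
    trace (suc m) y = trace m y + y ^ (q ℕ.^ m)

    y*eval-tracePoly : ∀ m y → y * eval F (tracePoly q m) y ≈ trace m y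
    y*eval-tracePoly zero    y = zeroʳ y
    y*eval-tracePoly (suc m) y = begin
      y * eval F (tracePoly q (suc m)) y             ≈⟨ *-congˡ (eval-+-monomial (tracePoly q m) d y) ⟩
      y * (eval F (tracePoly q m) y + y ^ d)         ≈⟨ distribˡ y _ _ ⟩
      y * eval F (tracePoly q m) y + y ^ suc d       ≈⟨ +-cong (y*eval-tracePoly m y) (^-congʳ y (ℕ.m+[n∸m]≡n (ℕ.m^n>0 q m))) ⟩
      trace m y + y ^ (q ℕ.^ m)                      ∎
      where d = q ℕ.^ m ℕ.∸ 1

    -- At a root y this reads 1 + y z = 0 and so exhibits an inverse of y.
    eval-tracePoly : ∀ m y → ∃[ z ] eval F (tracePoly q (suc m)) y ≈ 1# + y * z
    eval-tracePoly zero    y = 0# , refl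
    eval-tracePoly (suc m) y = z + y ^ (d ℕ.∸ 1) , (begin
      eval F (tracePoly q (suc (suc m))) y               ≈⟨ eval-+-monomial (tracePoly q (suc m)) d y ⟩
      eval F (tracePoly q (suc m)) y + y ^ d             ≈⟨ +-cong (proj₂ rest) (^-congʳ y (≡.sym (ℕ.m+[n∸m]≡n 1≤d))) ⟩
      (1# + y * z) + y * y ^ (d ℕ.∸ 1)                   ≈⟨ +-assoc _ _ _ ⟩
      1# + (y * z + y * y ^ (d ℕ.∸ 1))                   ≈⟨ +-congˡ (distribˡ y _ _) ⟨
      1# + y * (z + y ^ (d ℕ.∸ 1))                       ∎)
      where
      d = q ℕ.^ suc m ℕ.∸ 1
      1≤d : 1 ≤ d
      1≤d = ℕ.m<n⇒0<n∸m (ℕ.≤-<-trans (ℕ.m^n>0 q m) (q^m<q^1+m m))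
      rest = eval-tracePoly m y
      z = proj₁ rest

    -- A root of the trace polynomial divided by Y: the division removes the root 0, and the
    -- constant coefficient 1 that remains makes the root invertible. The degree q^m - 1 is positive
    -- because m is.
    traceZero : ∀ {m} → 1 ≤ m → ∃[ β ] ∃[ β⁻¹ ] (β * β⁻¹ ≈ 1# × trace (suc m) β ≈ 0#)
    traceZero {m} 1≤m = β , - z , β*-z≈1 , trans (sym (y*eval-tracePoly (suc m) β)) (trans (*-congˡ Tβ≈0) (zeroʳ β))
      where
      1≤d : 1 ≤ q ℕ.^ m ℕ.∸ 1
      1≤d = ℕ.m<n⇒0<n∸m (ℕ.^-monoʳ-< q 1<q 1≤m)
      root = monic⇒root {tracePoly q (suc m)} (tracePoly-monic m) 1≤d
      β = proj₁ root
      Tβ≈0 = proj₂ root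
      z = proj₁ (eval-tracePoly m β)
      β*-z≈1 : β * - z ≈ 1#
      β*-z≈1 = trans (sym (-‿distribʳ-* β z))
        (sym (inverseˡ-unique _ _ (trans (sym (proj₂ (eval-tracePoly m β))) Tβ≈0)))

    artinSchreier : ∀ β → ∃[ α ] α ^ q ≈ α + β
    artinSchreier β = α , (begin
      α ^ q                                  ≈⟨ inverseʳ-unique _ _ (trans (sym (eval-+-monomial low q α)) (proj₂ root)) ⟩
      - (- β + α * (- 1# + α * 0#))          ≈⟨ -‿cong (+-congˡ (*-congˡ (trans (+-congˡ (zeroʳ α)) (+-identityʳ _)))) ⟩
      - (- β + α * - 1#)                     ≈⟨ -‿cong (+-congˡ (trans (sym (-‿distribʳ-* α 1#)) (-‿cong (*-identityʳ α)))) ⟩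
      - (- β + - α)                          ≈⟨ -‿cong (-‿+-comm β α) ⟩
      - - (β + α)                            ≈⟨ -‿involutive _ ⟩
      β + α                                  ≈⟨ +-comm β α ⟩
      α + β                                  ∎)
      where
      -- The polynomial is Y^q - Y - β; as q > 1, its low terms stay below the leading one.
      low = - β ∷ - 1# ∷ []
      low-vanishes : VanishesFrom q (coeff F low)
      low-vanishes {zero}        q≤m = ⊥-elim (ℕ.<⇒≱ 1<q (ℕ.≤-trans q≤m z≤n))
      low-vanishes {suc zero}    q≤m = ⊥-elim (ℕ.<⇒≱ 1<q q≤m)
      low-vanishes {suc (suc m)} q≤m = refl
      root = monic⇒root {low +ₚ monomial q} (+-monomial-monic low q low-vanishes) (ℕ.<⇒≤ 1<q)
      α = proj₁ root

    -- Each further q-th power adds one more conjugate of β, and these conjugates accumulate to the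
    -- trace.
    artinSchreier-iterate : AdditivePower q → ∀ {α β} → α ^ q ≈ α + β →
      ∀ m → α ^ (q ℕ.^ m) ≈ α + trace m β
    artinSchreier-iterate q-add {α} {β} α^q≈α+β zero    = trans (*-identityʳ α) (sym (+-identityʳ α))
    artinSchreier-iterate q-add {α} {β} α^q≈α+β (suc m) = begin
      α ^ (q ℕ.* q ℕ.^ m)                       ≈⟨ ^-assocʳ α q (q ℕ.^ m) ⟨
      (α ^ q) ^ (q ℕ.^ m)                       ≈⟨ ^-congˡ (q ℕ.^ m) α^q≈α+β ⟩
      (α + β) ^ (q ℕ.^ m)                       ≈⟨ additivePower-^ {q} q-add m α β ⟩
      α ^ (q ℕ.^ m) + β ^ (q ℕ.^ m)             ≈⟨ +-congʳ (artinSchreier-iterate q-add α^q≈α+β m) ⟩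
      (α + trace m β) + β ^ (q ℕ.^ m)           ≈⟨ +-assoc _ _ _ ⟩
      α + trace (suc m) β                       ∎

    -- Additive Hilbert 90: an element β of trace zero has the form α^q - α, and iterating the q-th
    -- power 1 + m times returns to α. That β is invertible expresses that α lies outside F_q.
    periodicElement : AdditivePower q → ∀ {m} → 1 ≤ m →
      ∃[ α ] ∃[ β ] ∃[ β⁻¹ ] (α ^ q ≈ α + β × β * β⁻¹ ≈ 1# × α ^ (q ℕ.^ suc m) ≈ α)
    periodicElement q-add {m} 1≤m with β , β⁻¹ , ββ⁻¹≈1 , trace≈0 ← traceZero 1≤m
      with α , α^q≈α+β ← artinSchreier β =
      α , β , β⁻¹ , α^q≈α+β , ββ⁻¹≈1 ,
      trans (artinSchreier-iterate q-add α^q≈α+β (suc m)) (trans (+-congˡ trace≈0) (+-identityʳ α))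

-- These are exponents e with α^(q^e) = α^q for every α in F_{q^(1+r)}.
sparseExponent : ℕ → ℕ → ℕ
sparseExponent r s = 1 ℕ.+ suc r ℕ.* s

𝟏-refl : ∀ m → 𝟏 m m ≡ 1
𝟏-refl m = ≡.cong (λ b → if b then 1 else 0) (dec-true (m ℕ.≟ m) ≡.refl)

𝟏-≢ : ∀ {m n} → n ≢ m → 𝟏 m n ≡ 0
𝟏-≢ {m} {n} n≢m = ≡.cong (λ b → if b then 1 else 0) (dec-false (n ℕ.≟ m) n≢m)

-- Sums of K-th powers with coefficients, in an algebra over the field

module FieldAlgebra {c ℓ₁ ℓ₂ : Level} (F : HeytingField c ℓ₁ ℓ₂) (closed : AlgebraicallyClosed F)
  {a ℓ : Level} (R : CommutativeRing a ℓ)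
  {ι : HeytingField.Carrier F → CommutativeRing.Carrier R}
  (ι-homomorphism : IsRingHomomorphism (CommutativeRing.rawRing (Polynomials.𝔽 F)) (CommutativeRing.rawRing R) ι)
  where

  open Polynomials F using (𝔽)
  private module 𝔽 = CommutativeRing 𝔽
  module 𝔽^ where
    open import Algebra.Properties.Semiring.Exp 𝔽.semiring public using (_^_; ^-assocʳ; ^-congˡ)
    open import Algebra.Properties.Semiring.Sum 𝔽.semiring public using (sum)
    open import Algebra.Properties.Semiring.Mult 𝔽.semiring public using (_×_)
  open CommutativeRing R hiding (zero)
  open IsRingHomomorphism ι-homomorphism using (⟦⟧-cong; +-homo; *-homo; 0#-homo; 1#-homo)
  open SetoidReasoning setoid
  open NaturalSolver commutativeSemiring using (solve; con; _:+_; _:*_; _:=_)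
  open import Algebra.Properties.Semiring.Exp semiring
  open import Algebra.Properties.CommutativeSemiring.Exp commutativeSemiring using (^-distrib-*)
  open import Algebra.Properties.Semiring.Mult semiring using () renaming (_×_ to _·_)
  open import Algebra.Properties.Semiring.Sum semiring
  open Roots F closed
  open RingIdentities R

  ι-homo-^ : ∀ a n → ι (a 𝔽^.^ n) ≈ ι a ^ n
  ι-homo-^ a zero    = 1#-homo
  ι-homo-^ a (suc n) = trans (*-homo a (a 𝔽^.^ n)) (*-congˡ (ι-homo-^ a n))

  ι-homo-sum : ∀ {m} (a : Vector 𝔽.Carrier m) → ι (𝔽^.sum a) ≈ sum (λ i → ι (a i))
  ι-homo-sum {zero}  a = 0#-homo
  ι-homo-sum {suc m} a = trans (+-homo _ _) (+-congˡ (ι-homo-sum (λ i → a (Fin.suc i))))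

  ι-homo-· : ∀ n → ι (n 𝔽^.× 𝔽.1#) ≈ n · 1#
  ι-homo-· zero    = 0#-homo
  ι-homo-· (suc n) = trans (+-homo _ _) (+-cong 1#-homo (ι-homo-· n))

  scaledPower : ∀ {k b d} → d 𝔽^.^ k 𝔽.≈ b → ∀ l g → (ι d * g ^ l) ^ k ≈ ι b * g ^ (l ℕ.* k)
  scaledPower {k} {b} {d} d^k≈b l g = begin
    (ι d * g ^ l) ^ k          ≈⟨ ^-distrib-* (ι d) (g ^ l) k ⟩
    ι d ^ k * (g ^ l) ^ k      ≈⟨ *-cong (trans (sym (ι-homo-^ d k)) (⟦⟧-cong d^k≈b)) (^-assocʳ g l k) ⟩
    ι b * g ^ (l ℕ.* k)        ∎

  -- Coefficients remain separate until the end, where they are absorbed into k-th powers. The index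
  -- counts the terms exactly, which the bound depends on.
  data ScaledPowerSum (K : ℕ) : ℕ → Carrier → Set (c ⊔ a ⊔ ℓ) where
    nil  : ∀ {f} → f ≈ 0# → ScaledPowerSum K 0 f
    cons : ∀ {s f h} b g → ScaledPowerSum K s f → h ≈ ι b * g ^ K + f → ScaledPowerSum K (suc s) h

  scaledPowerSum-resp-≈ : ∀ {K s f g} → f ≈ g → ScaledPowerSum K s f → ScaledPowerSum K s g
  scaledPowerSum-resp-≈ f≈g (nil f≈0)           = nil (trans (sym f≈g) f≈0)
  scaledPowerSum-resp-≈ f≈g (cons b h rest f≈) = cons b h rest (trans (sym f≈g) f≈)

  scaledPowerSum-resp-≡ : ∀ {K s t f} → s ≡ t → ScaledPowerSum K s f → ScaledPowerSum K t f
  scaledPowerSum-resp-≡ ≡.refl f-sum = f-sum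

  scaledPowerSum-sum : ∀ {K m} (b : Vector 𝔽.Carrier m) (g : Vector Carrier m) {s f} → ScaledPowerSum K s f →
    ScaledPowerSum K (m ℕ.+ s) (sum (λ i → ι (b i) * g i ^ K) + f)
  scaledPowerSum-sum {m = zero}  b g f-sum = scaledPowerSum-resp-≈ (sym (+-identityˡ _)) f-sum
  scaledPowerSum-sum {m = suc m} b g f-sum =
    cons (b Fin.zero) (g Fin.zero) (scaledPowerSum-sum (λ i → b (Fin.suc i)) (λ i → g (Fin.suc i)) f-sum) (+-assoc _ _ _)

  -- Here n = q - 1, the list `ss` encodes e₂, ..., e_γ, so that γ = 1 + `length ss`, and w = q - γ.
  module _ {n : ℕ} (1≤n : 1 ≤ n) (q·1≈0 : suc n 𝔽^.× 𝔽.1# 𝔽.≈ 𝔽.0#)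
    (q-additive-𝔽 : RingIdentities.AdditivePower 𝔽 (suc n)) (q-additive : AdditivePower (suc n))
    {r : ℕ} (1≤r : 1 ≤ r) (ss : List ℕ) (w : ℕ) (w+γ≡q : w ℕ.+ suc (List.length ss) ≡ suc n)
    where

    q K : ℕ
    q = suc n
    K = 1 ℕ.+ sumₙ (List.map (λ s → q ℕ.^ sparseExponent r s) ss)

    μ : RootsOfUnity n
    μ = rootsOfUnity n 1≤n

    open RootsOfUnity μ using (root)

    points : Vector Carrier q
    points i = ι (0∷rootsOfUnity μ i)

    open WeightedSums points

    powerSum-ι : ∀ v → ι (RingIdentities.WeightedSums.powerSum 𝔽 (0∷rootsOfUnity μ) v) ≈ powerSum v
    powerSum-ι v = trans (ι-homo-sum {q} (λ i → 0∷rootsOfUnity μ i 𝔽^.^ v))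
      (sum-cong-≋ {q} (λ i → ι-homo-^ (0∷rootsOfUnity μ i) v))

    powerSum-< : ∀ {v} → v < n → powerSum v ≈ 0#
    powerSum-< {v} v<n = trans (sym (powerSum-ι v))
      (trans (⟦⟧-cong (0∷rootsOfUnity-powerSum-< μ q·1≈0 v<n)) 0#-homo)

    powerSum-n : powerSum n ≈ ι (𝔽.- 𝔽.1#)
    powerSum-n = trans (sym (powerSum-ι n)) (⟦⟧-cong (0∷rootsOfUnity-powerSum-n μ 1≤n q·1≈0))

    points-fixed : ∀ i → points i ^ q ≈ points i
    points-fixed i = trans (sym (ι-homo-^ (0∷rootsOfUnity μ i) q)) (⟦⟧-cong (0∷rootsOfUnity-fixed μ i))

    sparsePowers : Carrier → List Carrier
    sparsePowers x = List.map (λ s → x ^ (q ℕ.^ sparseExponent r s)) ss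

    T : Carrier → Carrier
    T x = weightedSum w (x ∷ sparsePowers x)

    M : Carrier → Carrier
    M x = total (sparsePowers x)

    ν κ : Carrier
    ν = ι (𝔽.- 𝔽.1#)
    κ = powerSum q

    -- The γ factors and the weight w give degree q = n + 1 in a, one above the first exponent whose
    -- power sum survives.
    T-additive : ∀ x → T x ≈ ν * (x + M x) + κ
    T-additive x = weightedSum-suc powerSum-< powerSum-n w (x ∷ sparsePowers x)
      (≡.trans (≡.cong (λ l → w ℕ.+ suc l) (length-map _ ss)) w+γ≡q)

    -- The same sum read term by term. The point 0 is split off, because its term 0^w x^K decides
    -- between the two forms of the bound.
    T-powers : ∀ x → T x ≈
      ι (𝔽.0# 𝔽^.^ w) * x ^ K + sum (λ i → ι (root i 𝔽^.^ w) * (x + ι (root i)) ^ K)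
    T-powers x = +-cong (trans (term Fin.zero) (*-congˡ (^-congˡ K (trans (+-congˡ 0#-homo) (+-identityʳ x)))))
                        (sum-cong-≋ (λ i → term (Fin.suc i)))
      where
      term : ∀ i → points i ^ w * shiftedProduct (points i) (x ∷ sparsePowers x) ≈
                   ι (0∷rootsOfUnity μ i 𝔽^.^ w) * (x + points i) ^ K
      term i = *-cong (sym (ι-homo-^ (0∷rootsOfUnity μ i) w))
        (*-congˡ (shiftedProduct-powers q-additive (points-fixed i) (sparseExponent r) x ss))

    -- The factor 0^v is 1 for v = 0, that is for γ = q, and 0 otherwise; this is where the
    -- indicator in the bound arises. The weight is generalised to v to allow the case split.
    zeroPoint-scaledPowerSum : ∀ v → v ℕ.+ suc (List.length ss) ≡ q → ∀ b x →
      ScaledPowerSum K (𝟏 q (suc (List.length ss))) (ι (𝔽.0# 𝔽^.^ v 𝔽.* b) * x ^ K)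
    zeroPoint-scaledPowerSum zero    γ≡q b x =
      scaledPowerSum-resp-≡ (≡.sym (≡.trans (≡.cong (𝟏 q) γ≡q) (𝟏-refl q)))
        (cons (𝔽.0# 𝔽^.^ zero 𝔽.* b) x (nil refl) (sym (+-identityʳ _)))
    zeroPoint-scaledPowerSum (suc v) 1+v+γ≡q b x =
      scaledPowerSum-resp-≡ (≡.sym (𝟏-≢ γ≢q))
        (nil (trans (*-congʳ (trans (⟦⟧-cong (𝔽.trans (𝔽.*-congʳ (𝔽.zeroˡ (𝔽.0# 𝔽^.^ v))) (𝔽.zeroˡ b))) 0#-homo)) (zeroˡ (x ^ K))))
      where
      γ≢q : suc (List.length ss) ≢ q
      γ≢q γ≡q = ℕ.m+1+n≢n v (≡.trans (ℕ.+-suc v _) (≡.trans 1+v+γ≡q (≡.sym γ≡q)))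

    module _ {α β : 𝔽.Carrier} (α^q≈α+β : α 𝔽^.^ q 𝔽.≈ α 𝔽.+ β) (α-periodic : α 𝔽^.^ (q ℕ.^ suc r) 𝔽.≈ α) where

      -- This is - α^q, the multiplier that makes the sparse parts cancel.
      δ : 𝔽.Carrier
      δ = 𝔽.- (α 𝔽.+ β)

      -- All exponents are 1 modulo 1 + r and α has period 1 + r under q-th powers, so every summand
      -- is scaled by the same α^q = α + β.
      M-scaled : ∀ x → M (ι α * x) ≈ ι (α 𝔽.+ β) * M x
      M-scaled x = total-powers-scaled (λ s → q ℕ.^ sparseExponent r s)
        (λ s → trans (sym (ι-homo-^ α (q ℕ.^ sparseExponent r s))) (⟦⟧-cong (α^[q^e]≈α^q s))) x ss
        where
        α^[q^e]≈α^q : ∀ s → α 𝔽^.^ (q ℕ.^ sparseExponent r s) 𝔽.≈ α 𝔽.+ β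
        α^[q^e]≈α^q s = 𝔽R.begin
          α 𝔽^.^ (q ℕ.* q ℕ.^ (suc r ℕ.* s))               𝔽R.≡⟨ ≡.cong (α 𝔽^.^_) (≡.trans (ℕ.*-comm q (q ℕ.^ (suc r ℕ.* s))) (≡.cong (ℕ._* q) (≡.sym (ℕ.^-*-assoc q (suc r) s)))) ⟩
          α 𝔽^.^ ((q ℕ.^ suc r) ℕ.^ s ℕ.* q)               𝔽R.≈⟨ 𝔽^.^-assocʳ α ((q ℕ.^ suc r) ℕ.^ s) q ⟨
          (α 𝔽^.^ ((q ℕ.^ suc r) ℕ.^ s)) 𝔽^.^ q            𝔽R.≈⟨ 𝔽^.^-congˡ q (RingIdentities.^-fixed 𝔽 α-periodic s) ⟩
          α 𝔽^.^ q                                         𝔽R.≈⟨ α^q≈α+β ⟩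
          α 𝔽.+ β                                          𝔽R.∎
          where module 𝔽R = SetoidReasoning 𝔽.setoid

      -- The sparse parts cancel by the choice of δ, and the linear part keeps the coefficient - (α
      -- - α^q) = β.
      T-combination : ∀ x → T (ι α * x) + ι δ * T x ≈ ι β * x + (1# + ι δ) * κ
      T-combination x = begin
        T (A * x) + D * T x
          ≈⟨ +-cong (trans (T-additive (A * x)) (+-congʳ (*-congˡ (+-congˡ (M-scaled x))))) (*-congˡ (T-additive x)) ⟩
        (ν * (A * x + A^q * M x) + κ) + D * (ν * (x + M x) + κ)
          ≈⟨ solve 7 (λ ν a x b m κ d → (ν :* (a :* x :+ b :* m) :+ κ) :+ d :* (ν :* (x :+ m) :+ κ) :=
                        (ν :* (a :+ d) :* x :+ (ν :* (b :+ d) :* m)) :+ (κ :+ d :* κ)) refl ν A x A^q (M x) κ D ⟩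
        (ν * (A + D) * x + ν * (A^q + D) * M x) + (κ + D * κ)
          ≈⟨ +-cong (+-cong (*-congʳ ν[A+D]≈β) (*-congʳ (*-congˡ A^q+D≈0))) (+-congʳ (sym (*-identityˡ κ))) ⟩
        (ι β * x + ν * 0# * M x) + (1# * κ + D * κ)
          ≈⟨ +-cong (trans (+-congˡ (trans (*-congʳ (zeroʳ ν)) (zeroˡ (M x)))) (+-identityʳ _)) (sym (distribʳ κ 1# D)) ⟩
        ι β * x + (1# + D) * κ
          ∎
        where
        A = ι α
        A^q = ι (α 𝔽.+ β)
        D = ι δ

        A^q+D≈0 : A^q + D ≈ 0#
        A^q+D≈0 = trans (sym (+-homo _ _)) (trans (⟦⟧-cong (𝔽.-‿inverseʳ (α 𝔽.+ β))) 0#-homo)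

        ν[A+D]≈β : ν * (A + D) ≈ ι β
        ν[A+D]≈β = trans (*-congˡ (sym (+-homo α δ))) (trans (sym (*-homo (𝔽.- 𝔽.1#) (α 𝔽.+ δ))) (⟦⟧-cong (𝔽R.begin
          𝔽.- 𝔽.1# 𝔽.* (α 𝔽.+ δ)                  𝔽R.≈⟨ -1*x≈-x _ ⟩
          𝔽.- (α 𝔽.+ 𝔽.- (α 𝔽.+ β))               𝔽R.≈⟨ ⁻¹-anti-homo-// α (α 𝔽.+ β) ⟩
          (α 𝔽.+ β) 𝔽.+ 𝔽.- α                     𝔽R.≈⟨ xyx⁻¹≈y α β ⟩
          β                                       𝔽R.∎)))
          where
          module 𝔽R = SetoidReasoning 𝔽.setoid
          open import Algebra.Properties.Ring 𝔽.ring using (-1*x≈-x)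
          open import Algebra.Properties.AbelianGroup 𝔽.+-abelianGroup using (⁻¹-anti-homo-//; xyx⁻¹≈y)

      -- Since (α x)^K = α^K x^K, the terms at the point 0 from both copies of T are multiples of
      -- x^K and merge into one, so that the indicator counts once and not twice.
      T-combination-powers : ∀ x → T (ι α * x) + ι δ * T x ≈
        sum (λ i → ι (root i 𝔽^.^ w) * (ι α * x + ι (root i)) ^ K) +
        (sum (λ i → ι (δ 𝔽.* root i 𝔽^.^ w) * (x + ι (root i)) ^ K) +
         ι (𝔽.0# 𝔽^.^ w 𝔽.* (α 𝔽^.^ K 𝔽.+ δ)) * x ^ K)
      T-combination-powers x = begin
        T (A * x) + D * T x
          ≈⟨ +-cong (T-powers (A * x)) (*-congˡ (T-powers x)) ⟩
        (E * (A * x) ^ K + sum t₁) + D * (E * x ^ K + sum t₂)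
          ≈⟨ +-congʳ (+-congʳ (*-congˡ (^-distrib-* A x K))) ⟩
        (E * (A ^ K * x ^ K) + sum t₁) + D * (E * x ^ K + sum t₂)
          ≈⟨ solve 6 (λ e a x s d t → (e :* (a :* x) :+ s) :+ d :* (e :* x :+ t) :=
                        s :+ (d :* t :+ e :* (a :+ d) :* x)) refl E (A ^ K) (x ^ K) (sum t₁) D (sum t₂) ⟩
        sum t₁ + (D * sum t₂ + E * (A ^ K + D) * x ^ K)
          ≈⟨ +-congˡ (+-cong (trans (*-distribˡ-sum D t₂) (sum-cong-≋ scaled)) (*-congʳ coefficient)) ⟩
        sum t₁ + (sum (λ i → ι (δ 𝔽.* root i 𝔽^.^ w) * (x + ι (root i)) ^ K) +
                  ι (𝔽.0# 𝔽^.^ w 𝔽.* (α 𝔽^.^ K 𝔽.+ δ)) * x ^ K)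
          ∎
        where
        A = ι α
        D = ι δ
        E = ι (𝔽.0# 𝔽^.^ w)

        t₁ t₂ : Vector Carrier n
        t₁ i = ι (root i 𝔽^.^ w) * (A * x + ι (root i)) ^ K
        t₂ i = ι (root i 𝔽^.^ w) * (x + ι (root i)) ^ K

        scaled : ∀ i → D * t₂ i ≈ ι (δ 𝔽.* root i 𝔽^.^ w) * (x + ι (root i)) ^ K
        scaled i = trans (sym (*-assoc _ _ _)) (*-congʳ (sym (*-homo δ (root i 𝔽^.^ w))))

        coefficient : E * (A ^ K + D) ≈ ι (𝔽.0# 𝔽^.^ w 𝔽.* (α 𝔽^.^ K 𝔽.+ δ))
        coefficient = trans (*-congˡ (trans (+-congʳ (sym (ι-homo-^ α K))) (sym (+-homo _ δ)))) (sym (*-homo _ (α 𝔽^.^ K 𝔽.+ δ)))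

      T-combination-scaledPowerSum : ∀ x →
        ScaledPowerSum K (n ℕ.+ (n ℕ.+ 𝟏 q (suc (List.length ss)))) (T (ι α * x) + ι δ * T x)
      T-combination-scaledPowerSum x = scaledPowerSum-resp-≈ (sym (T-combination-powers x))
        (scaledPowerSum-sum (λ i → root i 𝔽^.^ w) (λ i → ι α * x + ι (root i))
          (scaledPowerSum-sum (λ i → δ 𝔽.* root i 𝔽^.^ w) (λ i → x + ι (root i))
            (zeroPoint-scaledPowerSum w w+γ≡q (α 𝔽^.^ K 𝔽.+ δ) x)))

      -- By `T-combination` the equation is β x + b = f, with b constant and β invertible.
      T-combination-surjective : ∀ {β⁻¹} → β 𝔽.* β⁻¹ 𝔽.≈ 𝔽.1# → ∀ f → ∃[ x ] T (ι α * x) + ι δ * T x ≈ f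
      T-combination-surjective {β⁻¹} ββ⁻¹≈1 f = x , (begin
        T (ι α * x) + ι δ * T x                ≈⟨ T-combination x ⟩
        ι β * (ι β⁻¹ * (f - b)) + b            ≈⟨ +-congʳ (*-assoc (ι β) (ι β⁻¹) (f - b)) ⟨
        ι β * ι β⁻¹ * (f - b) + b              ≈⟨ +-congʳ (*-congʳ (trans (sym (*-homo β β⁻¹)) (trans (⟦⟧-cong ββ⁻¹≈1) 1#-homo))) ⟩
        1# * (f - b) + b                       ≈⟨ +-congʳ (*-identityˡ _) ⟩
        (f - b) + b                            ≈⟨ +-assoc f (- b) b ⟩
        f + (- b + b)                          ≈⟨ +-congˡ (-‿inverseˡ b) ⟩
        f + 0#                                 ≈⟨ +-identityʳ f ⟩
        f                                      ∎)
        where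
        b = (1# + ι δ) * κ
        x = ι β⁻¹ * (f - b)

    isScaledPowerSum : ∀ f → ScaledPowerSum K (2 ℕ.* n ℕ.+ 𝟏 q (suc (List.length ss))) f
    isScaledPowerSum f =
      let α , β , β⁻¹ , α^q≈α+β , ββ⁻¹≈1 , α-periodic = periodicElement (s≤s 1≤n) q-additive-𝔽 1≤r
          x , combination≈f = T-combination-surjective α^q≈α+β α-periodic ββ⁻¹≈1 f
      in scaledPowerSum-resp-≡ size≡
           (scaledPowerSum-resp-≈ combination≈f (T-combination-scaledPowerSum α^q≈α+β α-periodic x))
      where
      size≡ : n ℕ.+ (n ℕ.+ 𝟏 q (suc (List.length ss))) ≡ 2 ℕ.* n ℕ.+ 𝟏 q (suc (List.length ss))
      size≡ = ≡.trans (≡.sym (ℕ.+-assoc n n _)) (≡.cong (λ m → n ℕ.+ m ℕ.+ 𝟏 q (suc (List.length ss))) (≡.sym (ℕ.+-identityʳ n)))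

-- Arithmetic of the exponents: a sparse multiple K of k

open import Data.Nat.Base using (_+_; _*_; _∸_; _^_)
open import Data.Nat.Properties
open import Relation.Binary.PropositionalEquality
open +-*-Solver using (solve; _:+_; _:*_; _:=_; con)

≡mod⇒+ : ∀ {a b k} → b ≤ a → a ≡ b [mod k ] → ∃[ c ] a ≡ b + k * c
≡mod⇒+ {a} {b} {k} b≤a (divides c ∣a-b∣≡c*k) = c , (begin
  a                  ≡⟨ m+[n∸m]≡n b≤a ⟨
  b + (a ℕ.∸ b)      ≡⟨ cong (b +_) (m≤n⇒∣n-m∣≡n∸m b≤a) ⟨
  b + ℕ.∣ a - b ∣    ≡⟨ cong (b +_) (trans ∣a-b∣≡c*k (*-comm c k)) ⟩
  b + k * c          ∎)
  where open ≡-Reasoning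

module _ {p k r c : ℕ} (p^r≡1+kc : p ^ r ≡ 1 + k * c) where
  open ≡-Reasoning

  p^[r*x]≡1+k* : ∀ x → ∃[ d ] p ^ (r * x) ≡ 1 + k * d
  p^[r*x]≡1+k* zero = 0 , trans (cong (p ^_) (*-zeroʳ r)) (cong suc (sym (*-zeroʳ k)))
  p^[r*x]≡1+k* (suc x) with d , p^rx≡1+kd ← p^[r*x]≡1+k* x = c + d + c * (k * d) , (begin
    p ^ (r * suc x)                    ≡⟨ cong (p ^_) (*-suc r x) ⟩
    p ^ (r + r * x)                    ≡⟨ ^-distribˡ-+-* p r (r * x) ⟩
    p ^ r * p ^ (r * x)                ≡⟨ cong₂ _*_ p^r≡1+kc p^rx≡1+kd ⟩
    (1 + k * c) * (1 + k * d)          ≡⟨ solve 3 (λ k c d → (con 1 :+ k :* c) :* (con 1 :+ k :* d) := con 1 :+ k :* (c :+ d :+ c :* (k :* d))) refl k c d ⟩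
    1 + k * (c + d + c * (k * d))      ∎)

  p^[j+r*x]≡p^j+k* : ∀ j x → ∃[ d ] p ^ (j + r * x) ≡ p ^ j + k * d
  p^[j+r*x]≡p^j+k* j x with d , p^rx≡1+kd ← p^[r*x]≡1+k* x = p ^ j * d , (begin
    p ^ (j + r * x)          ≡⟨ ^-distribˡ-+-* p j (r * x) ⟩
    p ^ j * p ^ (r * x)      ≡⟨ cong (p ^ j *_) p^rx≡1+kd ⟩
    p ^ j * (1 + k * d)      ≡⟨ solve 3 (λ a k d → a :* (con 1 :+ k :* d) := a :+ k :* (a :* d)) refl (p ^ j) k d ⟩
    p ^ j + k * (p ^ j * d)  ∎)

sum-map-+multiple : ∀ {A : Set} {f g : A → ℕ} {k} → (∀ x → ∃[ d ] f x ≡ g x + k * d) →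
  ∀ xs → ∃[ d ] sumₙ (map f xs) ≡ sumₙ (map g xs) + k * d
sum-map-+multiple {k = k} f≡g []       = 0 , sym (*-zeroʳ k)
sum-map-+multiple {f = f} {g} {k} f≡g (x ∷ xs)
  with d , fx≡ ← f≡g x | d′ , rest ← sum-map-+multiple {f = f} {g} {k} f≡g xs = d + d′ ,
  trans (cong₂ _+_ fx≡ rest)
    (solve 5 (λ a b k d e → (a :+ k :* d) :+ (b :+ k :* e) := (a :+ b) :+ k :* (d :+ e)) refl (g x) (sumₙ (map g xs)) k d d′)

-- Turns the digit sum into the length of a list, namely the number of powers of b that add up to
-- the number expanded.
exponents : ∀ {b} → ℕ → Expansion b → List ℕ
exponents i []       = []
exponents i (d ∷ ds) = replicate (Fin.toℕ d) i ++ exponents (suc i) ds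

length-exponents : ∀ {b} i (ds : Expansion b) → length (exponents i ds) ≡ sumₙ (map Fin.toℕ ds)
length-exponents i []       = refl
length-exponents i (d ∷ ds) = trans (length-++ (replicate (Fin.toℕ d) i))
  (cong₂ _+_ (length-replicate (Fin.toℕ d)) (length-exponents (suc i) ds))

sum-replicate : ∀ n x → sumₙ (replicate n x) ≡ n * x
sum-replicate zero    x = refl
sum-replicate (suc n) x = cong (x +_) (sum-replicate n x)

sum-powers-exponents : ∀ {b} i (ds : Expansion b) →
  sumₙ (map (b ^_) (exponents i ds)) ≡ b ^ i * fromDigits ds
sum-powers-exponents {b} i [] = sym (*-zeroʳ (b ^ i))
sum-powers-exponents {b} i (d ∷ ds) = begin
  sumₙ (map (b ^_) (replicate (Fin.toℕ d) i ++ exponents (suc i) ds))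
    ≡⟨ cong sumₙ (map-++ (b ^_) (replicate (Fin.toℕ d) i) _) ⟩
  sumₙ (map (b ^_) (replicate (Fin.toℕ d) i) ++ map (b ^_) (exponents (suc i) ds))
    ≡⟨ sum-++ (map (b ^_) (replicate (Fin.toℕ d) i)) _ ⟩
  sumₙ (map (b ^_) (replicate (Fin.toℕ d) i)) + sumₙ (map (b ^_) (exponents (suc i) ds))
    ≡⟨ cong₂ _+_ (trans (cong sumₙ (map-replicate (b ^_) (Fin.toℕ d) i)) (sum-replicate (Fin.toℕ d) (b ^ i)))
                 (sum-powers-exponents (suc i) ds) ⟩
  Fin.toℕ d * b ^ i + b * b ^ i * fromDigits ds
    ≡⟨ solve 4 (λ d a b f → d :* a :+ b :* a :* f := a :* (d :+ f :* b)) refl (Fin.toℕ d) (b ^ i) b (fromDigits ds) ⟩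
  b ^ i * (Fin.toℕ d + fromDigits ds * b)
    ∎
  where open ≡-Reasoning

-- A lowest digit 0 would make b a common divisor. The exponent 0 obtained here stands for the
-- summand 1 of K, which accounts for the linear factor x + a.
exponents-0∷ : ∀ {b} (ds : Expansion b) → Coprime (fromDigits ds) b → b ≢ 1 →
  ∃[ js ] exponents 0 ds ≡ 0 ∷ js
exponents-0∷ {b} [] coprime b≢1 = ⊥-elim (b≢1 (coprime (divides 0 refl , ∣-refl)))
exponents-0∷ {b} (d ∷ ds) coprime b≢1 with Fin.toℕ d
... | zero  = ⊥-elim (b≢1 (coprime (divides (fromDigits ds) refl , ∣-refl)))
... | suc m = replicate m 0 ++ exponents 1 ds , refl

inverseModulo : ∀ u′ r′ → Coprime (suc u′) (suc r′) → ∃[ v ] ∃[ y ] suc u′ * v ≡ 1 + suc r′ * y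
inverseModulo u′ r′ coprime with coprime-Bézout coprime
... | Bézout.Identity.+- x y 1+yr≡xu = x , y ,
  trans (*-comm (suc u′) x) (trans (sym 1+yr≡xu) (cong suc (*-comm y (suc r′))))
-- Now - x is the inverse, and (r - 1) x represents it without subtraction; adding r keeps the
-- representative positive even for r = 1.
... | Bézout.Identity.-+ x y 1+xu≡yr = r′ * x + suc r′ , r′ * y + u′ , (begin
  suc u′ * (r′ * x + suc r′)                     ≡⟨ solve 3 (λ u r x → (con 1 :+ u) :* (r :* x :+ (con 1 :+ r)) := con 1 :+ (r :* (con 1 :+ x :* (con 1 :+ u)) :+ (con 1 :+ r) :* u)) refl u′ r′ x ⟩
  1 + (r′ * (1 + x * suc u′) + suc r′ * u′)      ≡⟨ cong (λ z → 1 + (r′ * z + suc r′ * u′)) 1+xu≡yr ⟩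
  1 + (r′ * (y * suc r′) + suc r′ * u′)          ≡⟨ solve 3 (λ u r y → con 1 :+ (r :* (y :* (con 1 :+ r)) :+ (con 1 :+ r) :* u) := con 1 :+ (con 1 :+ r) :* (r :* y :+ u)) refl u′ r′ y ⟩
  1 + suc r′ * (r′ * y + u′)                     ∎)
  where open ≡-Reasoning

digitExponents : ∀ {p} (p-prime : Prime p) {k} → Coprime k p →
  ∃[ js ] (suc (length js) ≡ γ p {{prime⇒nonTrivial p-prime}} k × 1 + sumₙ (map (p ^_) js) ≡ k)
digitExponents {p} p-prime {k} k⊥p =
  fromExpansion (proj₁ digits) (proj₂ digits)
  where
  open ≡-Reasoning
  digits = toDigits p {fromWitness (ℕ.nonTrivial⇒n>1 p {{prime⇒nonTrivial p-prime}})} k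

  fromExpansion : ∀ ds → fromDigits ds ≡ k →
    ∃[ js ] (suc (length js) ≡ sumₙ (map Fin.toℕ ds) × 1 + sumₙ (map (p ^_) js) ≡ k)
  fromExpansion ds ds≡k
    with js , exponents≡0∷js ← exponents-0∷ ds (subst (λ n → Coprime n p) (sym ds≡k) k⊥p)
                                 (λ p≡1 → ¬prime[1] (subst Prime p≡1 p-prime))
    = js
    , trans (cong length (sym exponents≡0∷js)) (length-exponents 0 ds)
    , (begin
        1 + sumₙ (map (p ^_) js)            ≡⟨ cong (λ js → sumₙ (map (p ^_) js)) exponents≡0∷js ⟨
        sumₙ (map (p ^_) (exponents 0 ds))  ≡⟨ sum-powers-exponents 0 ds ⟩
        p ^ 0 * fromDigits ds              ≡⟨ *-identityˡ _ ⟩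
        fromDigits ds                      ≡⟨ ds≡k ⟩
        k                                  ∎)

-- Modulo r, the factor 1 + r becomes 1 and `r′` = r - 1 cancels the leading 1, so the exponent
-- reduces to v j, and u v reduces to 1. This solves e ≡ 1 modulo 1 + r and u e ≡ j modulo r
-- simultaneously.
sparseExponent-≡ : ∀ u r′ v y (let r = suc r′) → u * v ≡ 1 + r * y → ∀ j →
  u * sparseExponent r (v * j + r′) ≡ j + r * (j + y * suc r * j + u * r)
sparseExponent-≡ u r′ v y uv≡1+ry j = begin
  u * (1 + suc r * (v * j + r′))
    ≡⟨ solve 4 (λ u r v j → u :* (con 1 :+ (con 2 :+ r) :* (v :* j :+ r)) :=
                            u :* v :* (con 2 :+ r) :* j :+ u :* (con 1 :+ r) :* (con 1 :+ r)) refl u r′ v j ⟩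
  u * v * suc r * j + u * r * r
    ≡⟨ cong (λ w → w * suc r * j + u * r * r) uv≡1+ry ⟩
  (1 + r * y) * suc r * j + u * r * r
    ≡⟨ solve 4 (λ u r y j → (con 1 :+ r :* y) :* (con 1 :+ r) :* j :+ u :* r :* r :=
                            j :+ r :* (j :+ y :* (con 1 :+ r) :* j :+ u :* r)) refl u r y j ⟩
  j + r * (j + y * suc r * j + u * r)
    ∎
  where
  open ≡-Reasoning
  r = suc r′

-- Replacing p^j by q^e = p^(u e) with u e ≡ j modulo r changes a summand by a multiple of k,
-- because p^r ≡ 1 modulo k. Doing this to the powers of p that make up k changes k into a multiple
-- of k with the same number of summands.
sparseMultiple : ∀ {p} (p-prime : Prime p) {k} → Coprime k p →
  ∀ {r} → IsMultiplicativeOrder p k r → ∀ {u} → 1 ≤ u → Coprime u r →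
  ∃[ ss ] (suc (length ss) ≡ γ p {{prime⇒nonTrivial p-prime}} k ×
           k ∣ 1 + sumₙ (map (λ s → (p ^ u) ^ sparseExponent r s) ss))
sparseMultiple p-prime k⊥p {zero} order = ⊥-elim (1+n≰n (IsMultiplicativeOrder.positive order))
sparseMultiple {p} p-prime {k} k⊥p {r@(suc r′)} order {u@(suc u′)} 1≤u u⊥r
  with v , y , uv≡1+ry ← inverseModulo u′ r′ u⊥r
  with c , p^r≡1+kc ← ≡mod⇒+ {p ^ r} {1} {k} (m^n>0 p {{prime⇒nonZero p-prime}} r) (IsMultiplicativeOrder.a^r≡1 order)
  with js , length≡ , 1+sum≡k ← digitExponents p-prime k⊥p
  with D , sum-q≡sum-p+kD ← sum-map-+multiple {f = λ j → (p ^ u) ^ sparseExponent r (v * j + r′)} {p ^_} {k}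
         (λ j → subst (λ e → ∃[ d ] e ≡ p ^ j + k * d)
                  (sym (trans (^-*-assoc p u (sparseExponent r (v * j + r′))) (cong (p ^_) (sparseExponent-≡ u r′ v y uv≡1+ry j))))
                  (p^[j+r*x]≡p^j+k* {p} {k} {r} {c} p^r≡1+kc j (j + y * suc r * j + u * r))) js
  = map (λ j → v * j + r′) js
  , trans (cong suc (length-map _ js)) length≡
  , subst (k ∣_) sum≡ (∣m∣n⇒∣m+n ∣-refl (m∣m*n D))
  where
  open ≡-Reasoning

  sum≡ : k + k * D ≡ 1 + sumₙ (map (λ s → (p ^ u) ^ sparseExponent r s) (map (λ j → v * j + r′) js))
  sum≡ = begin
    k + k * D                                                                         ≡⟨ cong (_+ k * D) 1+sum≡k ⟨
    1 + sumₙ (map (p ^_) js) + k * D                                                 ≡⟨ cong suc sum-q≡sum-p+kD ⟨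
    1 + sumₙ (map (λ j → (p ^ u) ^ sparseExponent r (v * j + r′)) js)                ≡⟨ cong (λ l → 1 + sumₙ l) (map-∘ js) ⟩
    1 + sumₙ (map (λ s → (p ^ u) ^ sparseExponent r s) (map (λ j → v * j + r′) js))   ∎

-- The bound for the polynomial ring

module _ {c ℓ₁ ℓ₂ : Level} (F : HeytingField c ℓ₁ ℓ₂) where

  open Polynomials F
  private
    module 𝔽 = CommutativeRing 𝔽
    module ℙ = CommutativeRing polyRing
    module Raw = RawSemiringDefinitions (polyRawSemiring F)
  open Exp ℙ.semiring using () renaming (_^_ to _^ᵖ_)

  const-isRingHomomorphism : IsRingHomomorphism 𝔽.rawRing ℙ.rawRing const
  const-isRingHomomorphism = record
    { isSemiringHomomorphism = record
      { isNearSemiringHomomorphism = record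
        { +-isMonoidHomomorphism = record
          { isMagmaHomomorphism = record
            { isRelHomomorphism = record { cong = const-cong }
            ; homo = λ a b → ℙ.refl
            }
          ; ε-homo = const-0#
          }
        ; *-homo = const-homo-*
        }
      ; 1#-homo = ℙ.refl
      }
    ; -‿homo = const-homo-neg
    }

  -- The two exponentiations are over raw semirings with different equalities.
  ^-raw : ∀ f n → f ^ᵖ n ≡ f Raw.^ n
  ^-raw f zero    = refl
  ^-raw f (suc n) = cong (f ℙ.*_) (^-raw f n)

  waringNumber≤ : ∀ {s k} → EveryPolyIsSumOfAtMost F s k → WaringNumber≤ F k s
  waringNumber≤ {s} {k} everyPoly = everyPoly , bound
    where
    bound : ∀ v → IsWaringNumber F k v → v ≤∞ fin s
    bound (fin v) (_ , v-minimal) = [ v-minimal everyPoly ]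
    bound ∞       v-infinite      = ⊥-elim (v-infinite s everyPoly)

  module _ (closed : AlgebraicallyClosed F) where

    open FieldAlgebra F closed polyRing const-isRingHomomorphism
    open Roots F closed using (nthRoot)

    -- With d a k-th root of b, the term b g^(l k) is the k-th power of d g^l, so the number of
    -- terms does not change.
    scaledPowerSum⇒isSum : ∀ {k} → 1 ≤ k → ∀ l {s f} → ScaledPowerSum (l * k) s f → IsSumOfAtMost F s k f
    scaledPowerSum⇒isSum 1≤k l (nil f≈0) = 0 , (λ ()) , z≤n , at f≈0
    scaledPowerSum⇒isSum {k} 1≤k l (cons {f = f} {h} b g f-sum h≈) =
      let d , d^k≈b = nthRoot k 1≤k b
          m , e , m≤s , f≈Σ = scaledPowerSum⇒isSum 1≤k l f-sum
          y = const d ℙ.* g ^ᵖ l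
      in suc m , y Vector.∷ e , s≤s m≤s ,
         at (ℙ.trans {h} h≈
           (ℙ.+-cong {const b ℙ.* g ^ᵖ (l * k)} {y Raw.^ k} {f}
             (ℙ.trans (ℙ.sym (scaledPower d^k≈b l g)) (ℙ.reflexive (^-raw y k)))
             (record { at = f≈Σ })))

    isSumViaSparseMultiple : ∀ {q} → 1 < q → Mult._×_ 𝔽.semiring q 𝔽.1# 𝔽.≈ 𝔽.0# →
      RingIdentities.AdditivePower 𝔽 q → RingIdentities.AdditivePower polyRing q →
      ∀ {r} → 1 ≤ r → ∀ ss → suc (length ss) ≤ q →
      ∀ {k} → 1 ≤ k → k ∣ 1 + sumₙ (map (λ s → q ^ sparseExponent r s) ss) →
      ∀ f → IsSumOfAtMost F (2 * (q ∸ 1) + 𝟏 q (suc (length ss))) k f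
    isSumViaSparseMultiple {suc n} (s≤s 1≤n) q·1≈0 q-add-𝔽 q-add 1≤r ss γ≤q 1≤k (divides l K≡l*k) f =
      scaledPowerSum⇒isSum 1≤k l (subst (λ K → ScaledPowerSum K (2 * n + 𝟏 (suc n) (suc (length ss))) f) K≡l*k
        (isScaledPowerSum 1≤n q·1≈0 q-add-𝔽 q-add 1≤r ss (suc n ∸ suc (length ss)) (m∸n+n≡m γ≤q) f))

    isSumOfOne-1 : ∀ f → IsSumOfAtMost F 1 1 f
    isSumOfOne-1 f = 1 , (λ _ → f) , s≤s z≤n ,
      at (ℙ.sym {f ℙ.* ℙ.1# ℙ.+ ℙ.0#} (ℙ.trans {f ℙ.* ℙ.1# ℙ.+ ℙ.0#} (ℙ.+-identityʳ (f ℙ.* ℙ.1#)) (ℙ.*-identityʳ f)))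

    module _ {p : ℕ} (p-prime : Prime p) (char : HasCharacteristic F p) where

      p·1≈0 : Mult._×_ 𝔽.semiring p 𝔽.1# 𝔽.≈ 𝔽.0#
      p·1≈0 = Equivalence.from (char p) (divides 1 (sym (*-identityˡ p)))

      p·1≈0-poly : Mult._×_ ℙ.semiring p ℙ.1# ℙ.≈ ℙ.0#
      p·1≈0-poly = ℙ.trans (ℙ.sym (ι-homo-· p)) (ℙ.trans (const-cong p·1≈0) const-0#)

      everyPolyIsSum : ∀ {k} → Coprime k p → ∀ {r} → IsMultiplicativeOrder p k r → ∀ u → Coprime u r →
        γ p {{prime⇒nonTrivial p-prime}} k ≤ p ^ u →
        EveryPolyIsSumOfAtMost F (2 * (p ^ u ∸ 1) + 𝟏 (p ^ u) (γ p {{prime⇒nonTrivial p-prime}} k)) k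
      -- For u = 0 the bound on γ is 1, which leaves only the summand p^0 in k, so k = 1. Every
      -- polynomial is its own first power, and the indicator supplies that one term.
      everyPolyIsSum k⊥p order zero u⊥r γ≤1 f with digitExponents p-prime k⊥p
      ... | [] , 1≡γ , refl = subst (λ g → IsSumOfAtMost F (𝟏 1 g) 1 f) 1≡γ (isSumOfOne-1 f)
      ... | j ∷ js , 2+≡γ , _ with s≤s () ← subst (_≤ 1) (sym 2+≡γ) γ≤1
      everyPolyIsSum {k} k⊥p order u@(suc u′) u⊥r γ≤q f
        with ss , length≡γ , k∣K ← sparseMultiple p-prime k⊥p order (s≤s z≤n) u⊥r =
        subst (λ g → IsSumOfAtMost F (2 * (p ^ u ∸ 1) + 𝟏 (p ^ u) g) k f) length≡γ
          (isSumViaSparseMultiple 1<q (RingIdentities.∣⇒·≈0 𝔽 {p} p·1≈0 (m∣m*n (p ^ u′)) 𝔽.1#)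
            (RingIdentities.additivePower-^ 𝔽 {p} (RingIdentities.frobenius 𝔽 p-prime p·1≈0) u)
            (RingIdentities.additivePower-^ polyRing {p} (RingIdentities.frobenius polyRing p-prime p·1≈0-poly) u)
            (IsMultiplicativeOrder.positive order) ss (subst (_≤ p ^ u) (sym length≡γ) γ≤q) 1≤k k∣K f)
        where
        1<p : 1 < p
        1<p = ℕ.nonTrivial⇒n>1 p {{prime⇒nonTrivial p-prime}}

        1<q : 1 < p ^ u
        1<q = ^-monoʳ-< p 1<p {0} {u} (s≤s z≤n)

        1≤k : 1 ≤ k
        1≤k = subst (1 ≤_) (proj₂ (proj₂ (digitExponents p-prime k⊥p))) (s≤s z≤n)

theorem3 : ∀ {c ℓ₁ ℓ₂} (F : HeytingField c ℓ₁ ℓ₂) → AlgebraicallyClosed F →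
    (p : ℕ) (p-prime : Prime p) → HasCharacteristic F p →
    (k : ℕ) → Coprime k p →
    (r : ℕ) → IsMultiplicativeOrder p k r →
    (u : ℕ) → Coprime u r →
    γ p {{prime⇒nonTrivial p-prime}} k ≤ p ^ u →
    WaringNumber≤ F k (2 * (p ^ u ∸ 1) + 𝟏 (p ^ u) (γ p {{prime⇒nonTrivial p-prime}} k))
theorem3 F closed p p-prime char k k⊥p r order u u⊥r γ≤q =
  waringNumber≤ F (everyPolyIsSum F closed p-prime char k⊥p order u u⊥r γ≤q)
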